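{- Let $M\le G\le S_n$ and let $\psi: M\to S_m$ be a homomorphism. Suppose that the homomorphism $\varphi_0: G\to S_m$ extends $\psi$ (both given). Then the class of extensions of $\psi$ equivalent to $\varphi_0$ can be efficiently enumerated.
   Context: Permutation groups are given by lists of generators (at most $2n$ for a subgroup of $S_n$), and homomorphisms by their values on generators. A homomorphism $\varphi: G\to S_m$ extends $\psi$ if $\varphi|_M=\psi$. Two homomorphisms $\varphi_1,\varphi_2: G\to S_m$ are equivalent extensions of $\psi$ if both extend $\psi$ and there is $\lambda\in S_m$ with $\varphi_1(g)=\lambda^{ -1}\varphi_2(g)\lambda$ for all $g\in G$. A set $\mathcal S$ can be efficiently enumerated if an algorithm lists the elements of $\mathcal S$ at $\mathrm{poly}(n,m)$ marginal cost, where the marginal cost of the $i$-th element is the time spent between producing the $(i-1)$-st and the $i$-th elements. -}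

module Defs where

open import Algebra.Bundles using (Group)
open import Algebra.Bundles.Raw using (RawGroup)
open import Algebra.Morphism.Bundles using (GroupHomomorphism)
import Algebra.Morphism.GroupMonomorphism as GroupMonomorphism
open import Data.Fin.Base using (Fin; toℕ)
open import Data.Fin.Permutation
  using (Permutation′; _⟨$⟩ʳ_; _⟨$⟩ˡ_; _∘ₚ_; flip; inverseˡ; inverseʳ) renaming (id to idₚ; _≈_ to _≈ₚ_)
open import Data.List.Base using (List; []; _∷_; _++_; map; foldr; length; lookup; tabulate)
open import Data.List.Membership.Propositional using (_∈_)
open import Data.List.Membership.Propositional.Properties using (∈-lookup)
open import Data.List.Relation.Unary.All using (All)
open import Data.List.Relation.Unary.Unique.Propositional using (Unique)
open import Data.Nat.Base using (ℕ; zero; suc; _+_; _*_; _^_; _≤_)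
open import Data.Product.Base using (Σ; ∃-syntax; _×_; _,_; proj₁)
open import Data.Vec.Base as Vec using (Vec)
open import Function.Bundles using (_⇔_)
open import Level using (0ℓ)
open import Relation.Binary.PropositionalEquality using (_≡_; refl; sym; trans; cong)

-- Permutations act on the right: (π ∙ ρ) i = ρ (π i).

Sym : ℕ → Group 0ℓ 0ℓ
Sym n = record
  { Carrier = Permutation′ n
  ; _≈_     = _≈ₚ_
  ; _∙_     = _∘ₚ_
  ; ε       = idₚ
  ; _⁻¹     = flip
  ; isGroup = record
    { isMonoid = record
      { isSemigroup = record
        { isMagma = record
          { isEquivalence = record
            { refl  = λ _ → refl
            ; sym   = λ p i → sym (p i)
            ; trans = λ p q i → trans (p i) (q i)
            }
          ; ∙-cong = λ {_} {_} {σ} p q i → trans (cong (σ ⟨$⟩ʳ_) (p i)) (q _)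
          }
        ; assoc = λ _ _ _ _ → refl
        }
      ; identity = (λ _ _ → refl) , (λ _ _ → refl)
      }
    ; inverse = (λ π _ → inverseʳ π) , (λ π _ → inverseˡ π)
    ; ⁻¹-cong = λ {π} {ρ} p i →
        trans (cong (π ⟨$⟩ˡ_) (sym (inverseʳ ρ)))
              (trans (cong (π ⟨$⟩ˡ_) (sym (p (ρ ⟨$⟩ˡ i)))) (inverseˡ π))
    }
  }

data _∈⟨_⟩ {n : ℕ} : Permutation′ n → List (Permutation′ n) → Set where
  gen  : ∀ {S π}   → π ∈ S → π ∈⟨ S ⟩
  unit : ∀ {S}     → idₚ ∈⟨ S ⟩
  mult : ∀ {S π ρ} → π ∈⟨ S ⟩ → ρ ∈⟨ S ⟩ → (π ∘ₚ ρ) ∈⟨ S ⟩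
  inv  : ∀ {S π}   → π ∈⟨ S ⟩ → flip π ∈⟨ S ⟩
  resp : ∀ {S π ρ} → π ≈ₚ ρ → π ∈⟨ S ⟩ → ρ ∈⟨ S ⟩

_≤ᴳ_ : ∀ {n} → List (Permutation′ n) → List (Permutation′ n) → Set
S ≤ᴳ T = ∀ {π} → π ∈⟨ S ⟩ → π ∈⟨ T ⟩

⟨_⟩ : ∀ {n} → List (Permutation′ n) → Group 0ℓ 0ℓ
⟨_⟩ {n} S = record
  { isGroup = GroupMonomorphism.isGroup {G₁ = raw} {G₂ = Group.rawGroup (Sym n)} {⟦_⟧ = proj₁}
      record
        { isGroupHomomorphism = record
          { isMonoidHomomorphism = record
            { isMagmaHomomorphism = record
              { isRelHomomorphism = record { cong = λ p → p }
              ; homo              = λ _ _ _ → refl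
              }
            ; ε-homo = λ _ → refl
            }
          ; ⁻¹-homo = λ _ _ → refl
          }
        ; injective = λ p → p
        }
      (Group.isGroup (Sym n))
  }
  where
  raw : RawGroup 0ℓ 0ℓ
  raw = record
    { Carrier = Σ (Permutation′ n) (_∈⟨ S ⟩)
    ; _≈_     = λ x y → proj₁ x ≈ₚ proj₁ y
    ; _∙_     = λ (π , p) (ρ , q) → π ∘ₚ ρ , mult p q
    ; ε       = idₚ , unit
    ; _⁻¹     = λ (π , p) → flip π , inv p
    }

Hom : ∀ {n} → List (Permutation′ n) → ℕ → Set
Hom S m = GroupHomomorphism (Group.rawGroup ⟨ S ⟩) (Group.rawGroup (Sym m))

module _ {n m : ℕ} {S : List (Permutation′ n)} where

  open GroupHomomorphism using (⟦_⟧)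

  valuesOnGenerators : Hom S m → List (Permutation′ m)
  valuesOnGenerators φ = tabulate λ i → ⟦ φ ⟧ (lookup S i , gen (∈-lookup i))

  Extends : ∀ {T} → S ≤ᴳ T → Hom S m → Hom T m → Set
  Extends S≤T ψ φ = ∀ π (π∈S : π ∈⟨ S ⟩) → ⟦ φ ⟧ (π , S≤T π∈S) ≈ₚ ⟦ ψ ⟧ (π , π∈S)

  Conjugate : Hom S m → Hom S m → Set
  Conjugate φ₁ φ₂ =
    ∃[ l ] (∀ g → ⟦ φ₁ ⟧ g ≈ₚ (flip l ∘ₚ ⟦ φ₂ ⟧ g ∘ₚ l))

EquivalentExtensions : ∀ {n m} {S T : List (Permutation′ n)} →
                       S ≤ᴳ T → Hom S m → Hom T m → Hom T m → Set
EquivalentExtensions S≤T ψ φ₁ φ₂ =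
  Extends S≤T ψ φ₁ × Extends S≤T ψ φ₂ × Conjugate φ₁ φ₂

-- Model of computation: a first-order language with while loops over binary
-- trees (in the style of Jones's WHILE language), de Bruijn variables and an
-- output instruction.  Every evaluation step costs one tick.  Values are
-- immutable, so each step is O(1) pointer operations on a machine sharing
-- subtrees, for a fixed program; there is no unit-cost comparison or copying
-- of whole trees.  An output is also charged one tick; writing it out in full
-- costs its size, polynomial in n and m for the codes of homomorphisms below.

infixr 5 _•_

data Tree : Set where
  nil : Tree
  _•_ : Tree → Tree → Tree

data Program (k : ℕ) : Set where
  var   : Fin k → Program k
  nil   : Program k
  cons  : Program k → Program k → Program k
  let′  : Program k → Program (1 + k) → Program k
  -- case e a b: a if e is nil, else b with variable 0 the left and variable 1
  -- the right subtree of e.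
  case  : Program k → Program k → Program (2 + k) → Program k
  -- while e t b: variable 0 starts as e and, as long as t is not nil, is
  -- replaced by b; the result is its last value.
  while : Program k → Program (1 + k) → Program (1 + k) → Program k
  emit  : Program k → Program k

data Event : Set where
  tick : Event
  out  : Tree → Event

Trace : Set
Trace = List Event

infix 4 _⊢_⇓_∣_ _⊢[_,_]_⇓_∣_

mutual

  -- Deterministic and big-step: a derivation is a complete, halting run.

  data _⊢_⇓_∣_ {k : ℕ} (ρ : Vec Tree k) : Program k → Tree → Trace → Set where

    var : ∀ i → ρ ⊢ var i ⇓ Vec.lookup ρ i ∣ tick ∷ []

    nil : ρ ⊢ nil ⇓ nil ∣ tick ∷ []

    cons : ∀ {a b u v r s} →
           ρ ⊢ a ⇓ u ∣ r → ρ ⊢ b ⇓ v ∣ s →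
           ρ ⊢ cons a b ⇓ u • v ∣ tick ∷ r ++ s

    let′ : ∀ {a b u v r s} →
           ρ ⊢ a ⇓ u ∣ r → (u Vec.∷ ρ) ⊢ b ⇓ v ∣ s →
           ρ ⊢ let′ a b ⇓ v ∣ tick ∷ r ++ s

    case-nil : ∀ {e a b v r s} →
               ρ ⊢ e ⇓ nil ∣ r → ρ ⊢ a ⇓ v ∣ s →
               ρ ⊢ case e a b ⇓ v ∣ tick ∷ r ++ s

    case-cons : ∀ {e a b x y v r s} →
                ρ ⊢ e ⇓ x • y ∣ r → (x Vec.∷ y Vec.∷ ρ) ⊢ b ⇓ v ∣ s →
                ρ ⊢ case e a b ⇓ v ∣ tick ∷ r ++ s

    while : ∀ {e t b u v r s} →
            ρ ⊢ e ⇓ u ∣ r → ρ ⊢[ t , b ] u ⇓ v ∣ s →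
            ρ ⊢ while e t b ⇓ v ∣ tick ∷ r ++ s

    emit : ∀ {e v r} →
           ρ ⊢ e ⇓ v ∣ r →
           ρ ⊢ emit e ⇓ nil ∣ tick ∷ r ++ out v ∷ []

  data _⊢[_,_]_⇓_∣_ {k : ℕ} (ρ : Vec Tree k) (t b : Program (1 + k)) :
                    Tree → Tree → Trace → Set where

    stop : ∀ {u r} →
           (u Vec.∷ ρ) ⊢ t ⇓ nil ∣ r →
           ρ ⊢[ t , b ] u ⇓ u ∣ tick ∷ r

    step : ∀ {u v w x y q r s} →
           (u Vec.∷ ρ) ⊢ t ⇓ x • y ∣ q →
           (u Vec.∷ ρ) ⊢ b ⇓ v ∣ r →
           ρ ⊢[ t , b ] v ⇓ w ∣ s →
           ρ ⊢[ t , b ] u ⇓ w ∣ tick ∷ q ++ r ++ s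

outputs : Trace → List Tree
outputs []          = []
outputs (tick  ∷ t) = outputs t
outputs (out v ∷ t) = v ∷ outputs t

-- Ticks before the first output, between consecutive outputs, and from the
-- last output to the halt; the argument counts the ticks already spent.
marginalCostsFrom : ℕ → Trace → List ℕ
marginalCostsFrom k []          = k ∷ []
marginalCostsFrom k (tick  ∷ t) = marginalCostsFrom (suc k) t
marginalCostsFrom k (out _ ∷ t) = k ∷ marginalCostsFrom 0 t

marginalCosts : Trace → List ℕ
marginalCosts = marginalCostsFrom 0

-- One program serves all instances.  It lists the set without repetition, and
-- c * (1 + n + m) ^ d ranges over bounds dominating every polynomial in n, m.
EfficientlyEnumerable :
  {Instance : Set} (n m : Instance → ℕ) (input : Instance → Tree)
  {Element : Instance → Set} (code : ∀ {I} → Element I → Tree)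
  (Member : ∀ I → Element I → Set) → Set
EfficientlyEnumerable {Instance} n m input code Member =
  ∃[ p ] ∃[ c ] ∃[ d ] ((I : Instance) →
    ∃[ v ] ∃[ t ]
      ((input I Vec.∷ Vec.[]) ⊢ p ⇓ v ∣ t
      × Unique (outputs t)
      × (∀ x → x ∈ outputs t ⇔ (∃[ e ] (Member I e × code e ≡ x)))
      × All (_≤ c * (1 + n I + m I) ^ d) (marginalCosts t)))

-- Numbers are coded in unary, which is polynomial here since permutation
-- degrees are the size parameters.

codeList : List Tree → Tree
codeList = foldr _•_ nil

codeℕ : ℕ → Tree
codeℕ zero    = nil
codeℕ (suc k) = nil • codeℕ k

codePerm : ∀ {n} → Permutation′ n → Tree
codePerm π = codeList (tabulate λ i → codeℕ (toℕ (π ⟨$⟩ʳ i)))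

codePerms : ∀ {n} → List (Permutation′ n) → Tree
codePerms S = codeList (map codePerm S)

codeHom : ∀ {n m} {S : List (Permutation′ n)} → Hom S m → Tree
codeHom φ = codePerms (valuesOnGenerators φ)

record ExtensionInstance : Set where
  field
    n m        : ℕ
    gensM      : List (Permutation′ n)
    gensG      : List (Permutation′ n)
    gensM≤2n   : length gensM ≤ 2 * n
    gensG≤2n   : length gensG ≤ 2 * n
    M≤G        : gensM ≤ᴳ gensG
    ψ          : Hom gensM m
    φ₀         : Hom gensG m
    φ₀-extends : Extends M≤G ψ φ₀

  input : Tree
  input = codeℕ n • codeℕ m • codePerms gensM • codeHom ψ • codePerms gensG • codeHom φ₀

  Extension : Set
  Extension = Hom gensG m

  EquivalentToφ₀ : Extension → Set
  EquivalentToφ₀ φ = EquivalentExtensions M≤G ψ φ φ₀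

{-# OPTIONS --safe #-}
-- Let A be the list of values of φ₀ on the generators of G and B that of ψ on the
-- generators of M.  The extensions equivalent to φ₀ are the conjugates of φ₀ by the
-- centralizer L of B, and two elements of L give the same extension iff they lie in the
-- same coset of the centralizer K ≤ L of A.  The cosets are enumerated by depth-first
-- search for the values μ(0), μ(1), … of a representative μ, where μ(i) has to be the
-- least point of its orbit under the stabilizer of μ(0), …, μ(i − 1) in K.  A prefix
-- that extends to L has an admissible next value, so the search never runs into a dead
-- end and reaches the next leaf after at most m steps.
--
-- Both conditions on μ(i) ask whether a partial map extends to a permutation commuting
-- with given permutations.  It does iff its closure under their simultaneous action on
-- arguments and values is a partial injection: by finiteness, isomorphic invariant sets
-- have isomorphic complements.
module Submission where

open import Algebra.Bundles using (Group)
open import Algebra.Morphism.Bundles using (GroupHomomorphism)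
open import Data.Fin using (#_)
open import Data.Fin.Base as Fin using (Fin; zero; suc; toℕ; fromℕ<; combine; _↑ʳ_)
import Data.Fin.Induction as FinInduction
open import Data.Fin.Patterns
open import Data.Fin.Permutation
  using (Permutation′; permutation; _⟨$⟩ʳ_; _⟨$⟩ˡ_; _∘ₚ_; flip; inverseˡ; inverseʳ) renaming (id to idₚ; _≈_ to _≈ₚ_)
import Data.Fin.Properties as Fin
open import Data.List.Base
  using ( List; []; _∷_; _++_; _ʳ++_; length; lookup; map; concatMap; foldl; foldr; filter; reverse
        ; replicate; tabulate; allFin; downFrom; upTo; applyUpTo )
import Data.List.Membership.DecPropositional as DecMembership
open import Data.List.Membership.Propositional using (_∈_; _∉_; find; lose)
open import Data.List.Membership.Propositional.Properties
  using ( ∈-lookup; ∈-map⁺; ∈-map⁻; ∈-filter⁺; ∈-filter⁻; ∈-allFin; ∈-concatMap⁺; ∈-concatMap⁻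
        ; ∈-tabulate⁺; ∈-tabulate⁻ )
open import Data.List.Properties
open import Data.List.Relation.Binary.Disjoint.Propositional using (Disjoint)
open import Data.List.Relation.Unary.All as All using (All; []; _∷_)
import Data.List.Relation.Unary.All.Properties as All
open import Data.List.Relation.Unary.AllPairs using (AllPairs; []; _∷_)
import Data.List.Relation.Unary.AllPairs.Properties as AllPairs
open import Data.List.Relation.Unary.Any using (Any; here; there; index)
open import Data.List.Relation.Unary.Any.Properties using (lookup-index; reverse⁺)
open import Data.List.Relation.Unary.Unique.Propositional using (Unique)
import Data.List.Relation.Unary.Unique.Propositional.Properties as Unique
open import Data.Nat.Base
open import Data.Nat.Properties
open import Data.Nat.Solver using (module +-*-Solver)
open import Data.Product.Base using (∃-syntax; _×_; _,_; proj₁; proj₂)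
import Data.Product.Properties as Product
open import Data.Sum.Base using (_⊎_; inj₁; inj₂)
open import Data.Vec.Base as Vec using (Vec; []; _∷_)
open import Data.Vec.Properties using (lookup-map)
open import Function.Base using (_∘_)
open import Function.Bundles using (_⇔_; mk⇔; Equivalence)
open import Function.Definitions using (Injective)
open import Induction.WellFounded as WellFounded using (Acc)
open import Relation.Binary.Definitions using (tri<; tri≈; tri>)
open import Relation.Binary.PropositionalEquality hiding (resp)
open import Relation.Nullary.Decidable using (Dec; yes; no; _×-dec_; _→-dec_; ¬?)
open import Relation.Nullary.Negation using (¬_; contradiction)

open import Defs

-- A clocked sublanguage

-- A total sublanguage of the tree programs: the only loop is a fold over the
-- spine of a list that is cut off after N steps, N being a clock fixed in
-- advance.  The cost of an expression is thus bounded independently of its data.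

-- A conjugate of φ₀ by μ extends ψ exactly when conjugation by μ fixes the image of ψ pointwise;
-- this is the origin of L. Both L and a single coset of K can be exponentially large, so listing L
-- and discarding repetitions could take exponential time between two outputs. Each coset therefore
-- gets a canonical representative: the admissible values are those of its lexicographically least
-- element. Neither centralizer is computed as a group; both enter only through the question whether
-- a partial map extends to one of their elements. Since marginal costs are counted for an actual
-- program, every loop needs a time bound. A clock computed once from n and m bounds all folds in
-- advance, so that the cost of one round of the search can be read off from the shape of the
-- expressions.

data Expr (k : ℕ) : Set where
  var   : Fin k → Expr k
  nil   : Expr k
  clock : Expr k
  cons  : Expr k → Expr k → Expr k
  bind  : Expr k → Expr (1 + k) → Expr k
  case  : Expr k → Expr k → Expr (2 + k) → Expr k
  -- In the body of a fold, variable 0 is the element and 1 the accumulator.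
  fold  : Expr k → Expr k → Expr (2 + k) → Expr k
  app   : ∀ {j} → Expr j → Vec (Fin k) j → Expr k

branch : Tree → Tree → (Tree → Tree → Tree) → Tree
branch nil     a b = a
branch (x • y) a b = b x y

foldTree : ℕ → (Tree → Tree → Tree) → Tree → Tree → Tree
foldTree zero    f l        a = a
foldTree (suc n) f nil      a = a
foldTree (suc n) f (x • xs) a = foldTree n f xs (f x a)

eval : ∀ {k} → ℕ → Expr k → Vec Tree k → Tree
eval N (var i)      ρ = Vec.lookup ρ i
eval N nil          ρ = nil
eval N clock        ρ = codeℕ N
eval N (cons a b)   ρ = eval N a ρ • eval N b ρ
eval N (bind a b)   ρ = eval N b (eval N a ρ ∷ ρ)
eval N (case e a b) ρ = branch (eval N e ρ) (eval N a ρ) (λ x y → eval N b (x ∷ y ∷ ρ))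
eval N (fold l a b) ρ = foldTree N (λ x acc → eval N b (x ∷ acc ∷ ρ)) (eval N l ρ) (eval N a ρ)
eval N (app e is)   ρ = eval N e (Vec.map (Vec.lookup ρ) is)

lift₂ : ∀ {j k} → (Fin j → Fin k) → Fin (2 + j) → Fin (2 + k)
lift₂ r zero          = zero
lift₂ r (suc zero)    = suc zero
lift₂ r (suc (suc i)) = suc (suc (r i))

-- The body of a fold sits below nine new variables: the loop state and two for each of the four
-- `case`s of `foldBody`. The accumulator ends up at position 3.
foldVars : ∀ {j k} → (Fin j → Fin k) → Fin (2 + j) → Fin (9 + k)
foldVars r zero          = 0F
foldVars r (suc zero)    = 3F
foldVars r (suc (suc i)) = 9 ↑ʳ r i

-- The state of the loop is remaining clock • (remaining list • accumulator).

foldTest : ∀ {k} → Program (1 + k)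
foldTest = case (var 0F) nil (case (var 0F) nil (case (var 3F) nil (var 0F)))

foldBody : ∀ {k} → Program (9 + k) → Program (1 + k)
foldBody b =
  case (var 0F) nil (case (var 0F) nil (case (var 3F) nil (case (var 0F) nil
    (cons (var 5F) (cons (var 1F) b)))))

-- `r` locates the source variables in the larger target environment and `c` locates the clock.
-- Composing renamings turns `app` into inlining, so a call costs no ticks of its own.
compile : ∀ {j k} → (Fin j → Fin k) → Fin k → Expr j → Program k
compile r c (var i)      = var (r i)
compile r c nil          = nil
compile r c clock        = var c
compile r c (cons a b)   = cons (compile r c a) (compile r c b)
compile r c (bind a b)   = let′ (compile r c a) (compile (λ { zero → zero ; (suc i) → suc (r i) }) (suc c) b)
compile r c (case e a b) = case (compile r c e) (compile r c a) (compile (lift₂ r) (2 ↑ʳ c) b)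
compile r c (fold l a b) =
  case (while (cons (var c) (cons (compile r c l) (compile r c a)))
              foldTest (foldBody (compile (foldVars r) (9 ↑ʳ c) b)))
    -- Projects the final loop state to its accumulator.
    nil (case (var 1F) nil (var 1F))
compile r c (app e is)   = compile (λ i → r (Vec.lookup is i)) c e

-- Runs without output and their costs

ticks : ℕ → Trace
ticks k = replicate k tick

ticks-+ : ∀ k l → ticks k ++ ticks l ≡ ticks (k + l)
ticks-+ zero    l = refl
ticks-+ (suc k) l = cong (tick ∷_) (ticks-+ k l)

Runs : ∀ {k} → Vec Tree k → Program k → Tree → ℕ → Set
Runs ρ p v B = ∃[ k ] (k ≤ B × ρ ⊢ p ⇓ v ∣ ticks k)

LoopRuns : ∀ {k} → Vec Tree k → (t b : Program (1 + k)) → Tree → Tree → ℕ → Set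
LoopRuns ρ t b u v B = ∃[ k ] (k ≤ B × ρ ⊢[ t , b ] u ⇓ v ∣ ticks k)

module _ {k} {ρ : Vec Tree k} where

  runs-var : ∀ i → Runs ρ (var i) (Vec.lookup ρ i) 1
  runs-var i = 1 , ≤-refl , var i

  runs-nil : Runs ρ nil nil 1
  runs-nil = 1 , ≤-refl , nil

  runs-cons : ∀ {a b u v A B} → Runs ρ a u A → Runs ρ b v B →
              Runs ρ (cons a b) (u • v) (1 + (A + B))
  runs-cons (i , i≤ , p) (j , j≤ , q) =
    suc (i + j) , s≤s (+-mono-≤ i≤ j≤) ,
    subst (λ t → ρ ⊢ _ ⇓ _ ∣ tick ∷ t) (ticks-+ i j) (cons p q)

  runs-let : ∀ {a b u v A B} → Runs ρ a u A → Runs (u ∷ ρ) b v B →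
             Runs ρ (let′ a b) v (1 + (A + B))
  runs-let (i , i≤ , p) (j , j≤ , q) =
    suc (i + j) , s≤s (+-mono-≤ i≤ j≤) ,
    subst (λ t → ρ ⊢ _ ⇓ _ ∣ tick ∷ t) (ticks-+ i j) (let′ p q)

  runs-case-nil : ∀ {e a b v A B} → Runs ρ e nil A → Runs ρ a v B →
                  Runs ρ (case e a b) v (1 + (A + B))
  runs-case-nil (i , i≤ , p) (j , j≤ , q) =
    suc (i + j) , s≤s (+-mono-≤ i≤ j≤) ,
    subst (λ t → ρ ⊢ _ ⇓ _ ∣ tick ∷ t) (ticks-+ i j) (case-nil p q)

  runs-case-cons : ∀ {e a b x y v A B} → Runs ρ e (x • y) A → Runs (x ∷ y ∷ ρ) b v B →
                   Runs ρ (case e a b) v (1 + (A + B))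
  runs-case-cons (i , i≤ , p) (j , j≤ , q) =
    suc (i + j) , s≤s (+-mono-≤ i≤ j≤) ,
    subst (λ t → ρ ⊢ _ ⇓ _ ∣ tick ∷ t) (ticks-+ i j) (case-cons p q)

  runs-while : ∀ {e t b u v A B} → Runs ρ e u A → LoopRuns ρ t b u v B →
               Runs ρ (while e t b) v (1 + (A + B))
  runs-while (i , i≤ , p) (j , j≤ , q) =
    suc (i + j) , s≤s (+-mono-≤ i≤ j≤) ,
    subst (λ t → ρ ⊢ _ ⇓ _ ∣ tick ∷ t) (ticks-+ i j) (while p q)

  loop-stop : ∀ {t b u A} → Runs (u ∷ ρ) t nil A → LoopRuns ρ t b u u (1 + A)
  loop-stop (i , i≤ , p) = suc i , s≤s i≤ , stop p

  loop-step : ∀ {t b u v w x y A B C} → Runs (u ∷ ρ) t (x • y) A → Runs (u ∷ ρ) b v B →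
              LoopRuns ρ t b v w C → LoopRuns ρ t b u w (1 + (A + (B + C)))
  loop-step (i , i≤ , p) (j , j≤ , q) (l , l≤ , s) =
    suc (i + (j + l)) , s≤s (+-mono-≤ i≤ (+-mono-≤ j≤ l≤)) ,
    subst (λ t → ρ ⊢[ _ , _ ] _ ⇓ _ ∣ tick ∷ t)
      (trans (cong (ticks i ++_) (ticks-+ j l)) (ticks-+ i (j + l))) (step p q s)

runs-≤ : ∀ {k} {ρ : Vec Tree k} {p v A B} → A ≤ B → Runs ρ p v A → Runs ρ p v B
runs-≤ A≤B (i , i≤ , p) = i , ≤-trans i≤ A≤B , p

-- To be independent of the data, the bound adds up both branches of a `case` and charges a fold for
-- all `N` rounds, however short its list.
cost : ∀ {k} → ℕ → Expr k → ℕ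
cost N (var i)      = 1
cost N nil          = 1
cost N clock        = 1
cost N (cons a b)   = 1 + (cost N a + cost N b)
cost N (bind a b)   = 1 + (cost N a + cost N b)
cost N (case e a b) = 1 + (cost N e + (cost N a + cost N b))
cost N (fold l a b) =
  1 + ((1 + ((1 + (1 + (1 + (cost N l + cost N a)))) + (N * (20 + cost N b) + 8))) + 3)
cost N (app e is)   = cost N e

module _ {k} {ρ : Vec Tree k} {b : Program (9 + k)} {f : Tree → Tree → Tree} {B : ℕ}
         (body : ∀ x acc {y₁ y₂ y₃ y₄ y₅ y₆ y₇} →
                 Runs (x ∷ y₁ ∷ y₂ ∷ acc ∷ y₃ ∷ y₄ ∷ y₅ ∷ y₆ ∷ y₇ ∷ ρ) b (f x acc) B) where

  -- The loop may end with clock or list left over, hence the unspecified `x` and `y`. A round takes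
  -- 1 tick for the step, 7 for the test and 12 around the body; the last test takes 8 with its
  -- step.
  fold-loop : ∀ n l a → ∃[ x ] ∃[ y ]
    LoopRuns ρ foldTest (foldBody b) (codeℕ n • (l • a)) (x • (y • foldTree n f l a)) (n * (20 + B) + 8)
  fold-loop zero l a = _ , _ ,
    loop-stop (runs-≤ (m≤n+m 5 2)
      (runs-case-cons (runs-var 0F) (runs-case-nil (runs-var 0F) runs-nil)))
  fold-loop (suc n) nil a = _ , _ ,
    proj₁ stopped , ≤-trans (proj₁ (proj₂ stopped)) (m≤n+m 8 ((20 + B) + n * (20 + B))) , proj₂ (proj₂ stopped)
    where
    stopped : LoopRuns ρ foldTest (foldBody b) (codeℕ (suc n) • (nil • a)) (codeℕ (suc n) • (nil • a)) 8
    stopped =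
      loop-stop (runs-case-cons (runs-var 0F) (runs-case-cons (runs-var 0F)
        (runs-case-cons (runs-var 3F) (runs-var 0F))))
  fold-loop (suc n) (x • xs) a =
    let x′ , y′ , loop = fold-loop n xs (f x a)
        i , i≤ , p = loop-step
          (runs-case-cons (runs-var 0F) (runs-case-cons (runs-var 0F)
            (runs-case-cons (runs-var 3F) (runs-var 0F))))
          (runs-case-cons (runs-var 0F) (runs-case-cons (runs-var 0F) (runs-case-cons (runs-var 3F)
            (runs-case-cons (runs-var 0F) (runs-cons (runs-var 5F) (runs-cons (runs-var 1F) (body x a)))))))
          loop
    in x′ , y′ , i , ≤-trans i≤ (≤-reflexive (cong (20 +_) (sym (+-assoc B (n * (20 + B)) 8)))) , p

compile-runs : ∀ {j k N} (e : Expr j) {r : Fin j → Fin k} {c : Fin k} {σ : Vec Tree j} {ρ : Vec Tree k} →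
               Vec.lookup ρ c ≡ codeℕ N → (∀ i → Vec.lookup ρ (r i) ≡ Vec.lookup σ i) →
               Runs ρ (compile r c e) (eval N e σ) (cost N e)
compile-runs (var i) {r} {ρ = ρ} clk env = subst (λ v → Runs ρ _ v 1) (env i) (runs-var (r i))
compile-runs nil         clk env = runs-nil
compile-runs clock {c = c} {ρ = ρ} clk env = subst (λ v → Runs ρ _ v 1) clk (runs-var c)
compile-runs (cons a b)  clk env = runs-cons (compile-runs a clk env) (compile-runs b clk env)
compile-runs (bind a b)  clk env =
  runs-let (compile-runs a clk env) (compile-runs b clk λ { zero → refl ; (suc i) → env i })
compile-runs {N = N} (case e a b) {r} {c} {σ} {ρ} clk env
  with eval N e σ | compile-runs {N = N} e {r} {c} {σ} {ρ} clk env
... | nil   | runs = runs-≤ (s≤s (+-monoʳ-≤ (cost N e) (m≤m+n (cost N a) (cost N b))))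
                       (runs-case-nil runs (compile-runs a clk env))
... | x • y | runs = runs-≤ (s≤s (+-monoʳ-≤ (cost N e) (m≤n+m (cost N b) (cost N a))))
                       (runs-case-cons runs (compile-runs b clk
                         λ { zero → refl ; (suc zero) → refl ; (suc (suc i)) → env i }))
compile-runs {N = N} (fold l a b) {c = c} {σ} {ρ} clk env =
  let x , y , loop = fold-loop {f = λ x acc → eval N b (x ∷ acc ∷ σ)} {B = cost N b}
        (λ x acc → compile-runs b clk λ { zero → refl ; (suc zero) → refl ; (suc (suc i)) → env i })
        N (eval N l σ) (eval N a σ)
  in runs-case-cons
       (runs-while
         (runs-cons (subst (λ v → Runs ρ _ v 1) clk (runs-var c))
           (runs-cons (compile-runs l clk env) (compile-runs a clk env)))
         loop)
       (runs-case-cons (runs-var 1F) (runs-var 1F))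
compile-runs (app e is) {σ = σ} clk env =
  compile-runs e clk λ i → trans (env (Vec.lookup is i)) (sym (lookup-map i (Vec.lookup σ) is))

-- Polynomial bounds

Polynomial : (ℕ → ℕ) → Set
Polynomial f = ∃[ c ] ∃[ d ] (∀ N → f N ≤ c * (1 + N) ^ d)

poly-const : ∀ a → Polynomial (λ _ → a)
poly-const a = a , 0 , λ N → ≤-reflexive (sym (*-identityʳ a))

poly-id : Polynomial (λ N → N)
poly-id = 1 , 1 , λ N → ≤-trans (n≤1+n N) (≤-reflexive (sym (trans (*-identityˡ _) (*-identityʳ (1 + N)))))

poly-+ : ∀ {f g} → Polynomial f → Polynomial g → Polynomial (λ N → f N + g N)
poly-+ {f} {g} (c , d , f≤) (c′ , d′ , g≤) = c + c′ , d + d′ , λ N → begin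
  f N + g N                                          ≤⟨ +-mono-≤ (f≤ N) (g≤ N) ⟩
  c * (1 + N) ^ d + c′ * (1 + N) ^ d′                ≤⟨ +-mono-≤ (*-monoʳ-≤ c (^-monoʳ-≤ (1 + N) (m≤m+n d d′)))
                                                                 (*-monoʳ-≤ c′ (^-monoʳ-≤ (1 + N) (m≤n+m d′ d))) ⟩
  c * (1 + N) ^ (d + d′) + c′ * (1 + N) ^ (d + d′)   ≡⟨ *-distribʳ-+ _ c c′ ⟨
  (c + c′) * (1 + N) ^ (d + d′)                      ∎
  where open ≤-Reasoning

poly-* : ∀ {f g} → Polynomial f → Polynomial g → Polynomial (λ N → f N * g N)
poly-* {f} {g} (c , d , f≤) (c′ , d′ , g≤) = c * c′ , d + d′ , λ N → begin
  f N * g N                                ≤⟨ *-mono-≤ (f≤ N) (g≤ N) ⟩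
  c * (1 + N) ^ d * (c′ * (1 + N) ^ d′)    ≡⟨ [m*n]*[o*p]≡[m*o]*[n*p] c _ c′ _ ⟩
  c * c′ * ((1 + N) ^ d * (1 + N) ^ d′)    ≡⟨ cong (c * c′ *_) (^-distribˡ-+-* (1 + N) d d′) ⟨
  c * c′ * (1 + N) ^ (d + d′)              ∎
  where open ≤-Reasoning

cost-poly : ∀ {k} (e : Expr k) → Polynomial (λ N → cost N e)
cost-poly (var i)      = poly-const 1
cost-poly nil          = poly-const 1
cost-poly clock        = poly-const 1
cost-poly (cons a b)   = poly-+ (poly-const 1) (poly-+ (cost-poly a) (cost-poly b))
cost-poly (bind a b)   = poly-+ (poly-const 1) (poly-+ (cost-poly a) (cost-poly b))
cost-poly (case e a b) = poly-+ (poly-const 1) (poly-+ (cost-poly e) (poly-+ (cost-poly a) (cost-poly b)))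
cost-poly (fold l a b) =
  poly-+ (poly-const 1) (poly-+ (poly-+ (poly-const 1) (poly-+
    (poly-+ (poly-const 3) (poly-+ (cost-poly l) (cost-poly a)))
    (poly-+ (poly-* poly-id (poly-+ (poly-const 20) (cost-poly b))) (poly-const 8)))) (poly-const 3))
cost-poly (app e is)   = cost-poly e

-- Partial permutations commuting with a set of permutations

lookup-injective : ∀ {A : Set} {xs : List A} → Unique xs → Injective _≡_ _≡_ (lookup xs)
lookup-injective (_ ∷ u)    {zero}  {zero}  eq = refl
lookup-injective (x∉ ∷ u)   {zero}  {suc j} eq = contradiction eq (All.lookup x∉ (∈-lookup j))
lookup-injective (x∉ ∷ u)   {suc i} {zero}  eq = contradiction (sym eq) (All.lookup x∉ (∈-lookup i))
lookup-injective (_ ∷ u)    {suc i} {suc j} eq = cong suc (lookup-injective u eq)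

Unique-⊆⇒length≤ : ∀ {A : Set} {xs ys : List A} → Unique xs → (∀ {x} → x ∈ xs → x ∈ ys) →
                   length xs ≤ length ys
Unique-⊆⇒length≤ {xs = xs} {ys} u xs⊆ys = Fin.injective⇒≤ {f = position} λ {i} {j} eq →
  lookup-injective u (trans (lookup-index (xs⊆ys (∈-lookup i)))
    (trans (cong (lookup ys) eq) (sym (lookup-index (xs⊆ys (∈-lookup j))))))
  where
  position : Fin (length xs) → Fin (length ys)
  position i = index (xs⊆ys (∈-lookup i))

∉⇒Unique-∷ : ∀ {A : Set} {x : A} {xs} → x ∉ xs → Unique xs → Unique (x ∷ xs)
∉⇒Unique-∷ x∉xs u = All.tabulate (λ y∈xs x≡y → x∉xs (subst (_∈ _) (sym x≡y) y∈xs)) ∷ u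

-- A missed value could be added as the image of one more point, giving an injection of m + 1 points
-- into m.
injective⇒permutation : ∀ {m} (f : Fin m → Fin m) → Injective _≡_ _≡_ f →
                        ∃[ π ] (∀ x → π ⟨$⟩ʳ x ≡ f x)
injective⇒permutation {m} f f-inj =
  permutation f (proj₁ ∘ preimage) (proj₂ ∘ preimage) (λ x → f-inj (proj₂ (preimage (f x)))) , λ _ → refl
  where
  preimage : ∀ y → ∃[ x ] f x ≡ y
  preimage y with Fin.any? (λ x → f x Fin.≟ y)
  ... | yes found = found
  ... | no  y∉f   = contradiction (Fin.injective⇒≤ {f = f⁺} f⁺-inj) 1+n≰n
    where
    f⁺ : Fin (suc m) → Fin m
    f⁺ zero    = y
    f⁺ (suc x) = f x
    f⁺-inj : Injective _≡_ _≡_ f⁺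
    f⁺-inj {zero}  {zero}  _  = refl
    f⁺-inj {zero}  {suc x} eq = contradiction (x , sym eq) y∉f
    f⁺-inj {suc x} {zero}  eq = contradiction (x , eq) y∉f
    f⁺-inj {suc x} {suc z} eq = cong suc (f-inj eq)

Pair : ℕ → Set
Pair m = Fin m × Fin m

module _ {m : ℕ} where

  _≟ₓ_ : (p q : Pair m) → Dec (p ≡ q)
  _≟ₓ_ = Product.≡-dec Fin._≟_ Fin._≟_

  open DecMembership _≟ₓ_ public using (_∈?_)

  act : Permutation′ m → Pair m → Pair m
  act g (x , y) = g ⟨$⟩ʳ x , g ⟨$⟩ʳ y

  Commutes : Permutation′ m → List (Permutation′ m) → Set
  Commutes κ gs = ∀ {g} → g ∈ gs → ∀ x → κ ⟨$⟩ʳ (g ⟨$⟩ʳ x) ≡ g ⟨$⟩ʳ (κ ⟨$⟩ʳ x)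

  Maps : Permutation′ m → List (Pair m) → Set
  Maps κ P = ∀ {x y} → (x , y) ∈ P → κ ⟨$⟩ʳ x ≡ y

  Extendable : List (Permutation′ m) → List (Pair m) → Set
  Extendable gs P = ∃[ κ ] (Commutes κ gs × Maps κ P)

  Clash : Pair m → Pair m → Set
  Clash (x , y) (x′ , y′) = (x ≡ x′ × y ≢ y′) ⊎ (x ≢ x′ × y ≡ y′)

  Closed : List (Permutation′ m) → List (Pair m) → Set
  Closed gs R = ∀ {p g} → p ∈ R → g ∈ gs → act g p ∈ R

  graph-no-clash : ∀ {κ P p q} → Maps κ P → p ∈ P → q ∈ P → ¬ Clash p q
  graph-no-clash κP p∈ q∈ (inj₁ (refl , y≢)) = y≢ (trans (sym (κP p∈)) (κP q∈))
  graph-no-clash {κ} κP p∈ q∈ (inj₂ (x≢ , refl)) =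
    x≢ (trans (sym (inverseˡ κ)) (trans (cong (κ ⟨$⟩ˡ_) (trans (κP p∈) (sym (κP q∈)))) (inverseˡ κ)))

  permutation-injective : ∀ (π : Permutation′ m) {x y} → π ⟨$⟩ʳ x ≡ π ⟨$⟩ʳ y → x ≡ y
  permutation-injective π eq = trans (sym (inverseˡ π)) (trans (cong (π ⟨$⟩ˡ_) eq) (inverseˡ π))

  act-injective : ∀ g {p q} → act g p ≡ act g q → p ≡ q
  act-injective g eq = cong₂ _,_ (permutation-injective g (cong proj₁ eq)) (permutation-injective g (cong proj₂ eq))

  Unique⇒length≤ : {R : List (Pair m)} → Unique R → length R ≤ m * m
  Unique⇒length≤ {R} u = Fin.injective⇒≤ {f = λ i → combine (proj₁ (lookup R i)) (proj₂ (lookup R i))} λ {i} {j} eq →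
    lookup-injective u (
    let eq₁ , eq₂ = Fin.combine-injective (proj₁ (lookup R i)) _ (proj₁ (lookup R j)) _ eq in cong₂ _,_ eq₁ eq₂)

  -- The image of R under g lies in R and has the same size.
  Closed⁻¹ : ∀ {gs R} → Unique R → Closed gs R → ∀ {p g} → g ∈ gs → act g p ∈ R → p ∈ R
  Closed⁻¹ {gs} {R} u closed {p} {g} g∈gs gp∈R with act g p ∈? map (act g) R
  ... | yes gp∈gR = let q , q∈R , gp≡gq = ∈-map⁻ (act g) gp∈gR in subst (_∈ R) (sym (act-injective g gp≡gq)) q∈R
  ... | no  gp∉gR = contradiction
    (subst (_≤ length R) (cong suc (length-map (act g) R))
      (Unique-⊆⇒length≤ (∉⇒Unique-∷ gp∉gR (Unique.map⁺ (act-injective g) u)) λ where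
        (here refl) → gp∈R
        (there q∈)  → let q′ , q′∈R , q≡ = ∈-map⁻ (act g) q∈ in subst (_∈ R) (sym q≡) (closed q′∈R g∈gs)))
    1+n≰n

-- A partial injection of a finite set is completed to a permutation by sending
-- a point outside the domain to the end of its backward trajectory.  This
-- preserves commutation with permutations.

module Completion {m : ℕ} (R : List (Pair m)) (consistent : ∀ {p q} → p ∈ R → q ∈ R → ¬ Clash p q) where

  Dom Rng : Fin m → Set
  Dom x = ∃[ y ] (x , y) ∈ R
  Rng y = ∃[ x ] (x , y) ∈ R

  functional : ∀ {x y y′} → (x , y) ∈ R → (x , y′) ∈ R → y ≡ y′
  functional {y = y} {y′} p q with y Fin.≟ y′
  ... | yes y≡y′ = y≡y′
  ... | no  y≢y′ = contradiction (inj₁ (refl , y≢y′)) (consistent p q)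

  injective : ∀ {x x′ y} → (x , y) ∈ R → (x′ , y) ∈ R → x ≡ x′
  injective {x} {x′} p q with x Fin.≟ x′
  ... | yes x≡x′ = x≡x′
  ... | no  x≢x′ = contradiction (inj₂ (x≢x′ , refl)) (consistent p q)

  dom? : ∀ x → Dec (Dom x)
  dom? x = Fin.any? λ y → (x , y) ∈? R

  rng? : ∀ y → Dec (Rng y)
  rng? y = Fin.any? λ x → (x , y) ∈? R

  predecessor : Fin m → Fin m
  predecessor y with rng? y
  ... | yes (x , _) = x
  ... | no  _       = y

  predecessor-∈ : ∀ {y} → Rng y → (predecessor y , y) ∈ R
  predecessor-∈ {y} r with rng? y
  ... | yes (_ , xy∈R) = xy∈R
  ... | no  ¬r         = contradiction r ¬r

  predecessor-fixed : ∀ {y} → ¬ Rng y → predecessor y ≡ y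
  predecessor-fixed {y} ¬r with rng? y
  ... | yes r = contradiction r ¬r
  ... | no  _ = refl

  back : ℕ → Fin m → Fin m
  back zero    x = x
  back (suc k) x = predecessor (back k x)

  back-stuck : ∀ {i j x} → i ≤′ j → ¬ Rng (back i x) → ¬ Rng (back j x)
  back-stuck ≤′-refl        ¬r = ¬r
  back-stuck (≤′-step i≤′j) ¬r r = let ¬r′ = back-stuck i≤′j ¬r in ¬r′ (subst Rng (predecessor-fixed ¬r′) r)

  -- As `R` is functional, equal predecessors have equal successors, so a repetition can be shifted
  -- back to the start of the trajectory. There it exhibits `x` as a predecessor.
  back-collision : ∀ {x} i j → i < j → (∀ k → k < j → Rng (back k x)) → back i x ≡ back j x → Dom x
  back-collision {x} zero (suc j) _ r eq =
    back j x , subst (λ z → (z , back j x) ∈ R) (sym eq) (predecessor-∈ (r j ≤-refl))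
  back-collision (suc i) (suc j) (s≤s i<j) r eq =
    back-collision i j i<j (λ k k<j → r k (m<n⇒m<1+n k<j))
      (functional (predecessor-∈ (r i (m<n⇒m<1+n i<j)))
        (subst (λ z → (z , _) ∈ R) (sym eq) (predecessor-∈ (r j ≤-refl))))

  -- Otherwise the m + 1 points `back 0 x`, ..., `back m x` all have genuine predecessors, and by
  -- the pigeonhole principle two of them coincide.
  back-escapes : ∀ {x} → ¬ Dom x → ¬ Rng (back m x)
  back-escapes {x} ¬d r =
    let i , j , i<j , eq = Fin.pigeonhole (n<1+n m) (λ k → back (toℕ k) x)
    in ¬d (back-collision (toℕ i) (toℕ j) i<j (λ k k<j → early k (<-≤-trans k<j (Fin.toℕ≤pred[n] j))) eq)
    where
    early : ∀ k → k < m → Rng (back k x)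
    early k k<m with rng? (back k x)
    ... | yes r′ = r′
    ... | no ¬r′ = contradiction r (back-stuck (≤⇒≤′ (<⇒≤ k<m)) ¬r′)

  data _↝_ : Fin m → Fin m → Set where
    done : ∀ {x} → x ↝ x
    step : ∀ {x y z} → (x , y) ∈ R → y ↝ z → x ↝ z

  back-↝ : ∀ k x → back k x ↝ x
  back-↝ zero    x = done
  back-↝ (suc k) x with rng? (back k x)
  ... | yes (_ , ∈R) = step ∈R (back-↝ k x)
  ... | no  _        = back-↝ k x

  -- Forward paths are determined by their starting point. Hence the end of a backward trajectory
  -- remembers where it came from, which makes `complete` injective outside the domain.
  ↝-end : ∀ {z x x′} → z ↝ x → z ↝ x′ → ¬ Dom x → ¬ Dom x′ → x ≡ x′
  ↝-end done        done          _  _   = refl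
  ↝-end done        (step p _)    ¬d _   = contradiction (_ , p) ¬d
  ↝-end (step p _)  done          _  ¬d′ = contradiction (_ , p) ¬d′
  ↝-end (step p ps) (step p′ ps′) ¬d ¬d′ = ↝-end (subst (_↝ _) (functional p p′) ps) ps′ ¬d ¬d′

  complete : Fin m → Fin m
  complete x with dom? x
  ... | yes (y , _) = y
  ... | no  _       = back m x

  complete-∈ : ∀ {x y} → (x , y) ∈ R → complete x ≡ y
  complete-∈ {x} xy∈R with dom? x
  ... | yes (_ , ∈R) = functional ∈R xy∈R
  ... | no  ¬d       = contradiction (_ , xy∈R) ¬d

  complete-∉ : ∀ {x} → ¬ Dom x → complete x ≡ back m x
  complete-∉ {x} ¬d with dom? x
  ... | yes d = contradiction d ¬d
  ... | no  _ = refl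

  complete-injective : Injective _≡_ _≡_ complete
  complete-injective {x} {x′} eq with dom? x | dom? x′
  ... | yes (_ , p) | yes (_ , p′) = injective p (subst (λ z → (x′ , z) ∈ R) (sym eq) p′)
  -- Points of the domain have values in the range, all others have values outside it.
  ... | yes (_ , p) | no  ¬d′      = contradiction (x , subst (λ z → (x , z) ∈ R) eq p) (back-escapes ¬d′)
  ... | no  ¬d      | yes (_ , p′) = contradiction (x′ , subst (λ z → (x′ , z) ∈ R) (sym eq) p′) (back-escapes ¬d)
  ... | no  ¬d      | no  ¬d′      = ↝-end (back-↝ m x) (subst (_↝ x′) (sym eq) (back-↝ m x′)) ¬d ¬d′

  module _ (g : Permutation′ m) (fwd : ∀ {p} → p ∈ R → act g p ∈ R) (bwd : ∀ {p} → act g p ∈ R → p ∈ R) where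

    Rng-bwd : ∀ {y} → Rng (g ⟨$⟩ʳ y) → Rng y
    Rng-bwd {y} (x , ∈R) = _ , bwd (subst (λ z → (z , g ⟨$⟩ʳ y) ∈ R) (sym (inverseʳ g)) ∈R)

    Dom-bwd : ∀ {x} → Dom (g ⟨$⟩ʳ x) → Dom x
    Dom-bwd {x} (y , ∈R) = _ , bwd (subst (λ z → (g ⟨$⟩ʳ x , z) ∈ R) (sym (inverseʳ g)) ∈R)

    predecessor-commutes : ∀ y → predecessor (g ⟨$⟩ʳ y) ≡ g ⟨$⟩ʳ predecessor y
    predecessor-commutes y with rng? y
    ... | yes (_ , ∈R) = injective (predecessor-∈ (_ , fwd ∈R)) (fwd ∈R)
    ... | no  ¬r       = predecessor-fixed (¬r ∘ Rng-bwd)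

    back-commutes : ∀ k x → back k (g ⟨$⟩ʳ x) ≡ g ⟨$⟩ʳ back k x
    back-commutes zero    x = refl
    back-commutes (suc k) x = trans (cong predecessor (back-commutes k x)) (predecessor-commutes (back k x))

    complete-commutes : ∀ x → complete (g ⟨$⟩ʳ x) ≡ g ⟨$⟩ʳ complete x
    complete-commutes x with dom? x
    ... | yes (_ , ∈R) = complete-∈ (fwd ∈R)
    ... | no  ¬d       = trans (complete-∉ (¬d ∘ Dom-bwd)) (back-commutes m x)

closed⇒Extendable : ∀ {m gs} {R : List (Pair m)} → Unique R → Closed gs R →
                    (∀ {p q} → p ∈ R → q ∈ R → ¬ Clash p q) → Extendable gs R
closed⇒Extendable {gs = gs} {R} u closed consistent =
  let κ , κ≡ = injective⇒permutation complete complete-injective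
  in κ
   , (λ {g} g∈gs x → trans (κ≡ (g ⟨$⟩ʳ x)) (trans
        -- Completion also refers to the complements of domain and range, so `g` has to preserve `R`
        -- in both directions.
        (complete-commutes g (λ p∈R → closed p∈R g∈gs) (Closed⁻¹ u closed g∈gs) x)
        (cong (g ⟨$⟩ʳ_) (sym (κ≡ x)))))
   , (λ {x} xy∈R → trans (κ≡ x) (complete-∈ xy∈R))
  where open Completion R consistent

-- Search and arithmetic on codes

codeFin : ∀ {m} → Fin m → Tree
codeFin i = codeℕ (toℕ i)

codePair : ∀ {m} → Pair m → Tree
codePair (x , y) = codeFin x • codeFin y

codePairs : ∀ {m} → List (Pair m) → Tree
codePairs P = codeList (map codePair P)

-- nil stands for a failed search or for falsity.

data Found (Z : Set) (Q : Tree → Set) : Tree → Set where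
  none : Z → Found Z Q nil
  some : ∀ {x y} → Q (x • y) → Found Z Q (x • y)

Truth : Set → Tree → Set
Truth P = Found (¬ P) (λ _ → P)

mapFound : ∀ {Z Z′ Q Q′ t} → (Z → Z′) → (∀ {v} → Q v → Q′ v) → Found Z Q t → Found Z′ Q′ t
mapFound f g (none z) = none (f z)
mapFound f g (some q) = some (g q)

toDec : ∀ {P t} → Truth P t → Dec P
toDec (none ¬p) = no ¬p
toDec (some p)  = yes p

branch-Found : ∀ {Z Q Z′ Q′ t a b} → Found Z Q t → (Z → Found Z′ Q′ a) →
               (∀ {x y} → Q (x • y) → Found Z′ Q′ (b x y)) → Found Z′ Q′ (branch t a b)
branch-Found (none z) f g = f z
branch-Found (some q) f g = g q

foldTree-foldl : ∀ {A : Set} (code : A → Tree) f n as acc → length as ≤ n →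
                 foldTree n f (codeList (map code as)) acc ≡ foldl (λ acc a → f (code a) acc) acc as
foldTree-foldl code f zero    []       acc _        = refl
foldTree-foldl code f (suc n) []       acc _        = refl
foldTree-foldl code f (suc n) (a ∷ as) acc (s≤s ≤n) = foldTree-foldl code f n as (f (code a) acc) ≤n

foldl-push : ∀ {A : Set} (f : Tree → A → Tree) (h : A → Tree) → (∀ acc a → f acc a ≡ h a • acc) →
             ∀ as bs → foldl f (codeList bs) as ≡ codeList (map h as ʳ++ bs)
foldl-push f h f≡ []       bs = refl
foldl-push f h f≡ (a ∷ as) bs =
  trans (cong (λ t → foldl f t as) (f≡ (codeList bs) a)) (foldl-push f h f≡ as (h a ∷ bs))

foldTree-push : ∀ {A : Set} (code : A → Tree) (f : Tree → Tree → Tree) (h : A → Tree) n as →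
                (∀ a acc → f (code a) acc ≡ h a • acc) → length as ≤ n →
                foldTree n f (codeList (map code as)) nil ≡ codeList (map h (reverse as))
foldTree-push code f h n as f≡ ≤n = begin
  foldTree n f (codeList (map code as)) nil   ≡⟨ foldTree-foldl code f n as nil ≤n ⟩
  foldl (λ acc a → f (code a) acc) nil as     ≡⟨ foldl-push _ h (λ acc a → f≡ a acc) as [] ⟩
  codeList (map h as ʳ++ [])                  ≡⟨ cong codeList (map-ʳ++ h as) ⟨
  codeList (map h (reverse as))               ∎
  where open ≡-Reasoning

-- A fold cannot be left early, so a later hit overwrites an earlier one. Callers rely only on the
-- result coming from some hit.
findFirst : ∀ {k} → Expr k → Expr (2 + k) → Expr k
findFirst l b = fold l nil (case b (var 1F) (cons (var 0F) (var 1F)))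

module _ {A : Set} {code : A → Tree} {Z : A → Set} {Q : A → Tree → Set} {h : Tree → Tree → Tree} where

  search-spec : ∀ n as → length as ≤ n → (∀ {a} → a ∈ as → ∀ acc → Found (Z a) (Q a) (h (code a) acc)) → ∀ acc →
    let r = foldTree n (λ x acc → branch (h x acc) acc _•_) (codeList (map code as)) acc
    in (r ≡ acc × All Z as) ⊎ (∃[ x ] ∃[ y ] (r ≡ x • y × Any (λ a → Q a (x • y)) as))
  search-spec zero    []       _        found acc = inj₁ (refl , [])
  search-spec (suc n) []       _        found acc = inj₁ (refl , [])
  search-spec (suc n) (a ∷ as) (s≤s ≤n) found acc with h (code a) acc | found (here refl) acc
  ... | nil   | none z with search-spec n as ≤n (found ∘ there) acc
  ...   | inj₁ (eq , zs)         = inj₁ (eq , z ∷ zs)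
  ...   | inj₂ (x , y , eq , q)  = inj₂ (x , y , eq , there q)
  search-spec (suc n) (a ∷ as) (s≤s ≤n) found acc
      | x • y | some q with search-spec n as ≤n (found ∘ there) (x • y)
  ...   | inj₁ (eq , _)          = inj₂ (x , y , eq , here q)
  ...   | inj₂ (x , y , eq , q)  = inj₂ (x , y , eq , there q)

  findFirst-spec : ∀ {N} as → length as ≤ N → (∀ {a} → a ∈ as → ∀ acc → Found (Z a) (Q a) (h (code a) acc)) →
    Found (All Z as) (λ v → Any (λ a → Q a v) as)
          (foldTree N (λ x acc → branch (h x acc) acc _•_) (codeList (map code as)) nil)
  findFirst-spec {N} as ≤N found
    with foldTree N (λ x acc → branch (h x acc) acc _•_) (codeList (map code as)) nil
       | search-spec N as ≤N found nil
  ... | _ | inj₁ (refl , zs)         = none zs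
  ... | _ | inj₂ (_ , _ , refl , q)  = some q

tails : ℕ → Tree → Tree
tails zero    t = t
tails (suc k) t = tails k (branch t nil λ _ y → y)

tails-codeℕ : ∀ k a → tails k (codeℕ a) ≡ codeℕ (a ∸ k)
tails-codeℕ zero    a       = refl
tails-codeℕ (suc k) (suc a) = tails-codeℕ k a
tails-codeℕ (suc k) zero    = trans (tails-codeℕ k 0) (cong codeℕ (0∸n≡0 k))

tails-tabulate : ∀ {m} (f : Fin m → Tree) i → branch (tails (toℕ i) (codeList (tabulate f))) nil (λ x _ → x) ≡ f i
tails-tabulate f zero    = refl
tails-tabulate f (suc i) = tails-tabulate (f ∘ suc) i

true : ∀ {k} → Expr k
true = cons nil nil

opaque

  -- Serves two purposes: on unary numbers it is truncated subtraction, and on lists it gives access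
  -- to the entry at a given index.
  drop : Expr 2
  drop = fold (var 1F) (var 0F) (case (var 1F) nil (var 1F))

  drop-eval : ∀ {N} l k → k ≤ N → eval N drop (l ∷ codeℕ k ∷ []) ≡ tails k l
  drop-eval {N} l k k≤N = go N k l k≤N
    where
    go : ∀ n k l → k ≤ n → foldTree n (λ _ acc → branch acc nil λ _ y → y) (codeℕ k) l ≡ tails k l
    go zero    zero    l _         = refl
    go (suc n) zero    l _         = refl
    go (suc n) (suc k) l (s≤s k≤n) = go n k _ k≤n

monus-eval : ∀ {N} a k → k ≤ N → eval N drop (codeℕ a ∷ codeℕ k ∷ []) ≡ codeℕ (a ∸ k)
monus-eval a k k≤N = trans (drop-eval (codeℕ a) k k≤N) (tails-codeℕ k a)

monus-spec : ∀ {N} a k → k ≤ N → Found (a ≤ k) (λ _ → k < a) (eval N drop (codeℕ a ∷ codeℕ k ∷ []))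
monus-spec {N} a k k≤N = subst (Found _ _) (sym (monus-eval a k k≤N)) (go (a ∸ k) refl)
  where
  go : ∀ d → a ∸ k ≡ d → Found (a ≤ k) (λ _ → k < a) (codeℕ d)
  go zero    eq = none (m∸n≡0⇒m≤n eq)
  go (suc d) eq = some (≰⇒> λ a≤k → contradiction (trans (sym eq) (m≤n⇒m∸n≡0 a≤k)) λ ())

opaque

  equals : Expr 2
  equals = case (app drop (0F ∷ 1F ∷ [])) (case (app drop (1F ∷ 0F ∷ [])) true nil) nil

  equals-spec : ∀ {N a b} → a ≤ N → b ≤ N → Truth (a ≡ b) (eval N equals (codeℕ a ∷ codeℕ b ∷ []))
  equals-spec {a = a} {b} a≤N b≤N = branch-Found (monus-spec a b b≤N)
    (λ a≤b → branch-Found (monus-spec b a a≤N) (λ b≤a → some (≤-antisym a≤b b≤a)) (λ a<b → none (<⇒≢ a<b)))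
    (λ b<a → none (>⇒≢ b<a))

opaque

  nth : Expr 2
  nth = case (app drop (0F ∷ 1F ∷ [])) nil (var 0F)

  nth-eval : ∀ {N m} → m ≤ N → (g : Permutation′ m) (i : Fin m) →
             eval N nth (codePerm g ∷ codeFin i ∷ []) ≡ codeFin (g ⟨$⟩ʳ i)
  nth-eval m≤N g i =
    trans (cong (λ t → branch t nil λ x _ → x) (drop-eval (codePerm g) (toℕ i) (≤-trans (<⇒≤ (Fin.toℕ<n i)) m≤N)))
          (tails-tabulate _ i)

-- Programs for closure and extendability

opaque

  pairEqual : Expr 2
  pairEqual =
    case (var 0F) nil (case (var 3F) nil
      (case (app equals (2F ∷ 0F ∷ [])) nil (app equals (5F ∷ 3F ∷ []))))

opaque

  member : Expr 2
  member = findFirst (var 1F) (app pairEqual (2F ∷ 0F ∷ []))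

opaque

  actExpr : Expr 2
  actExpr = case (var 1F) nil (cons (app nth (2F ∷ 0F ∷ [])) (app nth (2F ∷ 1F ∷ [])))

opaque

  -- Searches for an element of P, or an image of an element of R under a
  -- generator, that is not in R.
  missing : Expr 3
  missing =
    case (findFirst (var 1F) (case (app member (0F ∷ 4F ∷ [])) (var 0F) nil))
      (findFirst (var 2F) (findFirst (var 2F)
        (bind (app actExpr (0F ∷ 2F ∷ [])) (case (app member (0F ∷ 7F ∷ [])) (var 0F) nil))))
      (cons (var 0F) (var 1F))

opaque

  -- The clock itself is the list folded over: each of the `N` rounds adds one missing pair, or does
  -- nothing once the set is saturated.
  closure : Expr 2
  closure =
    fold clock nil
      (case (app missing (2F ∷ 3F ∷ 1F ∷ [])) (var 1F) (cons (cons (var 0F) (var 1F)) (var 3F)))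

opaque

  clash : Expr 2
  clash =
    case (var 0F) nil (case (var 3F) nil
      (case (app equals (2F ∷ 0F ∷ [])) (app equals (3F ∷ 1F ∷ []))
        (case (app equals (5F ∷ 3F ∷ [])) true nil)))

opaque

  extendable : Expr 2
  extendable =
    bind closure (case (findFirst (var 0F) (findFirst (var 2F) (app clash (0F ∷ 2F ∷ [])))) true nil)

module _ {N m : ℕ} (m²<N : m * m < N) where

  m≤N : m ≤ N
  m≤N = ≤-trans (m≤m*m m) (<⇒≤ m²<N)
    where
    m≤m*m : ∀ m → m ≤ m * m
    m≤m*m zero    = z≤n
    m≤m*m (suc m) = m≤m*n (suc m) (suc m)

  toℕ≤N : (i : Fin m) → toℕ i ≤ N
  toℕ≤N i = ≤-trans (<⇒≤ (Fin.toℕ<n i)) m≤N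

  equalFin-spec : (x y : Fin m) → Truth (x ≡ y) (eval N equals (codeFin x ∷ codeFin y ∷ []))
  equalFin-spec x y = mapFound (_∘ cong toℕ) Fin.toℕ-injective (equals-spec (toℕ≤N x) (toℕ≤N y))

  opaque
    unfolding pairEqual

    pairEqual-spec : (p q : Pair m) → Truth (p ≡ q) (eval N pairEqual (codePair p ∷ codePair q ∷ []))
    pairEqual-spec (x , y) (x′ , y′) = branch-Found (equalFin-spec x x′)
      (λ x≢x′ → none (x≢x′ ∘ cong proj₁))
      (λ { refl → mapFound (_∘ cong proj₂) (cong (x ,_)) (equalFin-spec y y′) })

  opaque
    unfolding member

    member-spec : (q : Pair m) (R : List (Pair m)) → length R ≤ N →
                  Truth (q ∈ R) (eval N member (codePair q ∷ codePairs R ∷ []))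
    member-spec q R R≤N = mapFound (λ ∉R q∈R → All.lookup ∉R q∈R refl) (λ q∈R → q∈R)
      (findFirst-spec {h = λ t _ → eval N pairEqual (codePair q ∷ t ∷ [])} R R≤N λ {p} _ _ → pairEqual-spec q p)

  opaque
    unfolding actExpr

    actExpr-eval : ∀ g (p : Pair m) → eval N actExpr (codePerm g ∷ codePair p ∷ []) ≡ codePair (act g p)
    actExpr-eval g (x , y) = cong₂ _•_ (nth-eval m≤N g x) (nth-eval m≤N g y)

  opaque
    unfolding clash

    clash-spec : (p q : Pair m) → Truth (Clash p q) (eval N clash (codePair p ∷ codePair q ∷ []))
    clash-spec (x , y) (x′ , y′) = branch-Found (equalFin-spec x x′)
      (λ x≢x′ → mapFound (λ { y≢y′ (inj₁ (x≡x′ , _)) → x≢x′ x≡x′ ; y≢y′ (inj₂ (_ , y≡y′)) → y≢y′ y≡y′ })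
                         (λ y≡y′ → inj₂ (x≢x′ , y≡y′)) (equalFin-spec y y′))
      (λ x≡x′ → branch-Found (equalFin-spec y y′) (λ y≢y′ → some (inj₁ (x≡x′ , y≢y′)))
                  (λ y≡y′ → none λ { (inj₁ (_ , y≢y′)) → y≢y′ y≡y′ ; (inj₂ (x≢x′ , _)) → x≢x′ x≡x′ }))

  module _ (gs : List (Permutation′ m)) (gs≤N : length gs ≤ N) (P : List (Pair m)) (P≤N : length P ≤ N) where

    Candidate : List (Pair m) → Pair m → Set
    Candidate R q = q ∈ P ⊎ (∃[ p ] ∃[ g ] (p ∈ R × g ∈ gs × q ≡ act g p))

    Missing : List (Pair m) → Tree → Set
    Missing R v = ∃[ q ] (v ≡ codePair q × q ∉ R × Candidate R q)

    Full : List (Pair m) → Set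
    Full R = (∀ {p} → p ∈ P → p ∈ R) × Closed gs R

    Full⇒¬Missing : ∀ {R v} → Full R → ¬ Missing R v
    Full⇒¬Missing (P⊆R , closed) (q , _ , q∉R , inj₁ q∈P)                         = q∉R (P⊆R q∈P)
    Full⇒¬Missing (P⊆R , closed) (q , _ , q∉R , inj₂ (p , g , p∈R , g∈gs , refl)) = q∉R (closed p∈R g∈gs)

    absent-spec : (R : List (Pair m)) → length R ≤ N → (q : Pair m) →
      Found (q ∈ R) (λ v → v ≡ codePair q × q ∉ R)
            (branch (eval N member (codePair q ∷ codePairs R ∷ [])) (codePair q) (λ _ _ → nil))
    absent-spec R R≤N q = branch-Found (member-spec q R R≤N) (λ q∉R → some (refl , q∉R)) none

    opaque
      unfolding missing

      missing-spec : (R : List (Pair m)) → length R ≤ N →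
        Found (Full R) (Missing R) (eval N missing (codePerms gs ∷ codePairs P ∷ codePairs R ∷ []))
      missing-spec R R≤N = branch-Found
        (findFirst-spec {h = λ t _ → absent t} P P≤N λ {q} _ _ → absent-spec R R≤N q)
        (λ P⊆R → mapFound {Q = λ v → Any (λ p → Any (λ g → v ≡ codePair (act g p) × act g p ∉ R) gs) R}
          (λ closed → (λ p∈P → All.lookup P⊆R p∈P) , (λ p∈R g∈gs → All.lookup (All.lookup closed p∈R) g∈gs))
          (λ found → let p , p∈R , found′ = find found
                         g , g∈gs , v≡ , ∉R = find found′
                     in act g p , v≡ , ∉R , inj₂ (p , g , p∈R , g∈gs , refl))
          (findFirst-spec {Q = λ p v → Any (λ g → v ≡ codePair (act g p) × act g p ∉ R) gs}
            {h = λ t _ → foldTree N (λ u acc → branch (absent (eval N actExpr (u ∷ t ∷ []))) acc _•_)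
                          (codePerms gs) nil}
            R R≤N λ {p} _ _ →
            findFirst-spec {h = λ u _ → absent (eval N actExpr (u ∷ codePair p ∷ []))} gs gs≤N λ {g} _ _ →
            subst (λ t → Found (act g p ∈ R) (λ v → v ≡ codePair (act g p) × act g p ∉ R) (absent t))
              (sym (actExpr-eval g p)) (absent-spec R R≤N (act g p))))
        (λ found → let q , q∈P , v≡ , q∉R = find found in some (q , v≡ , q∉R , inj₁ q∈P))
        where
        absent : Tree → Tree
        absent t = branch (eval N member (t ∷ codePairs R ∷ [])) t (λ _ _ → nil)

    -- Every pair in the closure is forced upon all extensions of `P`, so that a clash refutes
    -- extendability.
    Sound : List (Pair m) → Set
    Sound R = ∀ κ → Commutes κ gs → Maps κ P → Maps κ R

    Sound-∷ : ∀ {R q} → Sound R → Candidate R q → Sound (q ∷ R)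
    Sound-∷ sound _ κ κgs κP (there xy∈R)    = sound κ κgs κP xy∈R
    Sound-∷ sound (inj₁ q∈P) κ κgs κP (here refl) = κP q∈P
    Sound-∷ sound (inj₂ (_ , g , p∈R , g∈gs , refl)) κ κgs κP (here refl) =
      trans (κgs g∈gs _) (cong (g ⟨$⟩ʳ_) (sound κ κgs κP p∈R))

    closureStep : Tree → Tree → Tree
    closureStep _ acc =
      branch (eval N missing (codePerms gs ∷ codePairs P ∷ acc ∷ [])) acc (λ x y → (x • y) • acc)

    -- Every step enlarges R until it is closed, and R never has more than m² elements.
    closure-iterate : ∀ n R → Unique R → Sound R → Full R ⊎ N ≤ n + length R →
      ∃[ R′ ] (Unique R′ × Sound R′ × Full R′ × foldTree n closureStep (codeℕ n) (codePairs R) ≡ codePairs R′)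
    closure-iterate zero    R u sound (inj₁ full) = R , u , sound , full , refl
    -- With no rounds left, `R` would have at least `N` pairs, and thus more than m².
    closure-iterate zero    R u sound (inj₂ N≤) =
      contradiction (≤-trans N≤ (Unique⇒length≤ u)) (<⇒≱ m²<N)
    closure-iterate (suc n) R u sound progress
      with eval N missing (codePerms gs ∷ codePairs P ∷ codePairs R ∷ [])
         | missing-spec R (≤-trans (Unique⇒length≤ u) (<⇒≤ m²<N))
    ... | nil   | none full = closure-iterate n R u sound (inj₁ full)
    ... | x • y | some absent@(q , refl , q∉R , candidate) =
      closure-iterate n (q ∷ R) (∉⇒Unique-∷ q∉R u) (Sound-∷ sound candidate) (progress′ progress)
      where
      progress′ : Full R ⊎ N ≤ suc n + length R → Full (q ∷ R) ⊎ N ≤ n + suc (length R)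
      progress′ (inj₁ full) = contradiction absent (Full⇒¬Missing full)
      progress′ (inj₂ N≤)   = inj₂ (subst (N ≤_) (sym (+-suc n (length R))) N≤)

    opaque
      unfolding closure

      closure-spec : ∃[ R ] (Unique R × Sound R × Full R ×
        eval N closure (codePerms gs ∷ codePairs P ∷ []) ≡ codePairs R)
      closure-spec = closure-iterate N [] [] (λ _ _ _ ()) (inj₂ (m≤m+n N 0))

    opaque
      unfolding extendable

      -- A closure without clashes is a partial injection, which `closed⇒Extendable` completes; a
      -- clash would have to occur in the graph of any extension.
      extendable-spec : Truth (Extendable gs P) (eval N extendable (codePerms gs ∷ codePairs P ∷ []))
      extendable-spec with eval N closure (codePerms gs ∷ codePairs P ∷ []) | closure-spec
      ... | _ | R , u , sound , full , refl = let R≤N = ≤-trans (Unique⇒length≤ u) (<⇒≤ m²<N) in branch-Found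
        (findFirst-spec
          {h = λ s _ → foldTree N (λ t acc → branch (eval N clash (t ∷ s ∷ [])) acc _•_) (codePairs R) nil}
          R R≤N λ {p} _ _ →
          findFirst-spec {h = λ t _ → eval N clash (t ∷ codePair p ∷ [])} R R≤N λ {q} _ _ → clash-spec q p)
        (λ consistent →
          let κ , κgs , κR = closed⇒Extendable u (proj₂ full) λ q∈R p∈R → All.lookup (All.lookup consistent p∈R) q∈R
          in some (κ , κgs , λ xy∈P → κR (proj₁ full xy∈P)))
        (λ found → none λ (κ , κgs , κP) →
          let p , p∈R , found′ = find found
              q , q∈R , clashing = find found′
          in graph-no-clash {κ = κ} (sound κ κgs κP) q∈R p∈R clashing)

-- Nodes of the search tree

m²<m²+ : ∀ m k → m * m < suc (m * m) + k
m²<m²+ m k = s≤s (m≤m+n (m * m) k)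

-- The specification of the program, taken at a clock large enough for the given lists, already
-- contains a decision.
extendable? : ∀ {m} (gs : List (Permutation′ m)) P → Dec (Extendable gs P)
extendable? {m} gs P = toDec (extendable-spec {N = suc (m * m) + (length gs + length P)} (m²<m²+ m _)
  gs (≤-trans (m≤m+n _ _) (m≤n+m _ (suc (m * m)))) P (≤-trans (m≤n+m _ (length gs)) (m≤n+m _ (suc (m * m)))))

-- Applied to all pairs of `P`, this gives the identity on the range of `P`; an extension of it is a
-- permutation that stabilizes the range pointwise.
diagonal : ∀ {m} → Pair m → Pair m
diagonal (_ , y) = y , y

-- A node is a partial map P with domain {0, …, i − 1}.  The image i ↦ y is
-- admissible if P ∪ {i ↦ y} extends to the centralizer of bs and y is the
-- least point of its orbit under the stabilizer of the range of P in the
-- centralizer of as.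

Admissible : ∀ {m} (bs as : List (Permutation′ m)) → Fin m → List (Pair m) → Fin m → Set
Admissible bs as i P y =
  Extendable bs ((i , y) ∷ P) × (∀ z → z Fin.< y → ¬ Extendable as ((y , z) ∷ map diagonal P))

admissible? : ∀ {m} (bs as : List (Permutation′ m)) i P y → Dec (Admissible bs as i P y)
admissible? bs as i P y = extendable? bs ((i , y) ∷ P) ×-dec
  Fin.all? λ z → (z Fin.<? y) →-dec ¬? (extendable? as ((y , z) ∷ map diagonal P))

children : ∀ {m} (bs as : List (Permutation′ m)) → Fin m → List (Pair m) → List (Fin m)
children {m} bs as i P = filter (admissible? bs as i P) (allFin m)

-- In terms of `Conjugate` the conjugating permutation is `flip μ`. With this orientation the result
-- depends only on the coset of all `μ ∘ₚ κ`, in which `κ` acts on the values of `μ`.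
conjugate : ∀ {m} → Permutation′ m → Permutation′ m → Permutation′ m
conjugate μ g = μ ∘ₚ g ∘ₚ flip μ

-- The diagonal is carried along and grows by one pair per level, instead of being recomputed for
-- each orbit test.
codeNode : ∀ {m} → ℕ → List (Pair m) → Tree
codeNode i P = codeℕ i • (codePairs P • codePairs (map diagonal P))

foldTree-reverse : ∀ {A : Set} (code : A → Tree) f n as acc → length as ≤ n →
                   foldTree n f (codeList (map code (reverse as))) acc ≡ foldr (λ a acc → f (code a) acc) acc as
foldTree-reverse code f n as acc ≤n =
  trans (foldTree-foldl code f n (reverse as) acc (subst (_≤ n) (sym (length-reverse as)) ≤n))
        (reverse-foldl (λ acc a → f (code a) acc) acc as)

foldr-• : ∀ {A : Set} (h : A → Tree) as → foldr (λ a acc → h a • acc) nil as ≡ codeList (map h as)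
foldr-• h []       = refl
foldr-• h (a ∷ as) = cong (h a •_) (foldr-• h as)

foldr-filter-• : ∀ {A : Set} {P : A → Set} (P? : ∀ a → Dec (P a)) (t h : A → Tree) → (∀ a → Truth (P a) (t a)) →
                 ∀ acc as →
                 foldr (λ a acc → branch (t a) acc λ _ _ → h a • acc) acc as ≡
                 foldr _•_ acc (map h (filter P? as))
foldr-filter-• P? t h spec acc []       = refl
foldr-filter-• P? t h spec acc (a ∷ as) with t a | spec a | P? a
... | _ | none ¬p | yes p = contradiction p ¬p
... | _ | none _  | no _  = foldr-filter-• P? t h spec acc as
... | _ | some _  | yes _ = cong (h a •_) (foldr-filter-• P? t h spec acc as)
... | _ | some p  | no ¬p = contradiction p ¬p

tabulate-applyUpTo : ∀ {A : Set} (f : ℕ → A) m → tabulate {n = m} (f ∘ toℕ) ≡ applyUpTo f m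
tabulate-applyUpTo f zero    = refl
tabulate-applyUpTo f (suc m) = cong (f 0 ∷_) (tabulate-applyUpTo (f ∘ suc) m)

descending-toℕ : ∀ m → map codeℕ (downFrom m) ≡ map codeFin (reverse (allFin m))
descending-toℕ m = begin
  map codeℕ (downFrom m)                     ≡⟨ cong (map codeℕ) (reverse-upTo m) ⟨
  map codeℕ (reverse (upTo m))               ≡⟨ cong (map codeℕ ∘ reverse) (tabulate-applyUpTo (λ i → i) m) ⟨
  map codeℕ (reverse (tabulate {n = m} toℕ))
    ≡⟨ cong (map codeℕ ∘ reverse) (map-tabulate {n = m} (λ i → i) toℕ) ⟨
  map codeℕ (reverse (map toℕ (allFin m)))   ≡⟨ cong (map codeℕ) (map-ʳ++ toℕ (allFin m)) ⟨
  map codeℕ (map toℕ (reverse (allFin m)))   ≡⟨ map-∘ (reverse (allFin m)) ⟨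
  map codeFin (reverse (allFin m))           ∎
  where open ≡-Reasoning

-- Programs for expanding a node and reading off a leaf

opaque

  -- A fold that pushes onto its accumulator reverses its list, so descending input leads to
  -- ascending results.
  countdown : Expr 1
  countdown =
    case (fold (var 0F) (cons nil nil) (case (var 1F) nil (cons (cons nil (var 0F)) (cons (var 0F) (var 1F)))))
      nil (var 1F)

  countdown-eval : ∀ {N} m → m ≤ N → eval N countdown (codeℕ m ∷ []) ≡ codeList (map codeFin (reverse (allFin m)))
  countdown-eval {N} m m≤N = trans (cong (λ t → branch t nil λ _ y → y) (go N m 0 m≤N))
    (cong codeList (trans (cong (map codeℕ ∘ downFrom) (+-identityʳ m)) (descending-toℕ m)))
    where
    next : Tree → Tree → Tree
    next _ acc = branch acc nil λ x y → (nil • x) • (x • y)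
    go : ∀ n m k → m ≤ n → foldTree n next (codeℕ m) (codeℕ k • codeList (map codeℕ (downFrom k))) ≡
                           codeℕ (m + k) • codeList (map codeℕ (downFrom (m + k)))
    go zero    zero    k _         = refl
    go (suc n) zero    k _         = refl
    go (suc n) (suc m) k (s≤s m≤n) =
      trans (go n m (suc k) m≤n) (cong (λ l → codeℕ l • codeList (map codeℕ (downFrom l))) (+-suc m k))

opaque

  reversed : Expr 1
  reversed = fold (var 0F) nil (cons (var 0F) (var 1F))

  reversed-eval : ∀ {A : Set} {N} (code : A → Tree) as → length as ≤ N →
                  eval N reversed (codeList (map code as) ∷ []) ≡ codeList (map code (reverse as))
  reversed-eval {N = N} code as ≤N = foldTree-push code _•_ code N as (λ _ _ → refl) ≤N

opaque

  unfinished : Expr 2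
  unfinished = case (var 0F) nil (app drop (3F ∷ 0F ∷ []))

  unfinished-eval : ∀ {N m} i {t} → i ≤ N → eval N unfinished ((codeℕ i • t) ∷ codeℕ m ∷ []) ≡ codeℕ (m ∸ i)
  unfinished-eval {m = m} i i≤N = monus-eval m i i≤N

-- The arguments are a node, a point y, the degree m, and the generators bs and as.

opaque

  admissible : Expr 5
  admissible =
    case (var 0F) nil (case (var 1F) nil
      (case (bind (cons (cons (var 2F) (var 5F)) (var 0F)) (app extendable (8F ∷ 0F ∷ [])))
        nil
        (case (findFirst (app countdown (8F ∷ []))
                (case (app drop (9F ∷ 0F ∷ [])) nil
                  (bind (cons (cons (var (# 11)) (var 2F)) (var 7F)) (app extendable (# 15 ∷ 0F ∷ [])))))
          true nil)))

opaque

  child : Expr 2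
  child =
    case (var 0F) nil (case (var 1F) nil
      (cons (cons nil (var 2F))
        (cons (cons (cons (var 2F) (var 5F)) (var 0F)) (cons (cons (var 5F) (var 5F)) (var 1F)))))

  child-eval : ∀ {N m} (i : Fin m) P y →
               eval N child (codeNode (toℕ i) P ∷ codeFin y ∷ []) ≡ codeNode (suc (toℕ i)) ((i , y) ∷ P)
  child-eval i P y = refl

-- The arguments are a node, a list to be extended by the children of the node,
-- the degree m, and the generators bs and as.

opaque

  expand : Expr 5
  expand =
    fold (app countdown (2F ∷ [])) (var 1F)
      (case (app admissible (2F ∷ 0F ∷ 4F ∷ 5F ∷ 6F ∷ [])) (var 1F)
        (cons (app child (4F ∷ 2F ∷ [])) (var 3F)))

opaque

  image : Expr 2
  image =
    -- The hit is wrapped by `cons nil`, since the code of the point 0 is `nil` and would pass for a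
    -- failed search.
    case (findFirst (var 0F) (case (var 0F) nil (case (app equals (0F ∷ 5F ∷ [])) nil (cons nil (var 3F)))))
      nil (var 1F)

opaque

  preimage : Expr 2
  preimage =
    case (findFirst (var 0F) (case (var 0F) nil (case (app equals (1F ∷ 5F ∷ [])) nil (cons nil (var 2F)))))
      nil (var 1F)

opaque

  conjugated : Expr 3
  conjugated =
    fold (app countdown (1F ∷ [])) nil
      (bind (app image (2F ∷ 0F ∷ [])) (bind (app nth (5F ∷ 0F ∷ []))
        (cons (app preimage (4F ∷ 0F ∷ [])) (var 3F))))

opaque

  result : Expr 3
  result =
    case (var 0F) nil (case (var 1F) nil
      (fold (app reversed (6F ∷ [])) nil (cons (app conjugated (2F ∷ 7F ∷ 0F ∷ [])) (var 1F))))

module _ {N m : ℕ} (m²<N : m * m < N) where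

  length-allFin≤N : length (allFin m) ≤ N
  length-allFin≤N = subst (_≤ N) (sym (length-tabulate {n = m} (λ i → i))) (m≤N m²<N)

  module _ (bs as : List (Permutation′ m)) (bs≤N : length bs ≤ N) (as≤N : length as ≤ N)
           (i : Fin m) (P : List (Pair m)) (P<N : length P < N) where

    opaque
      unfolding admissible

      admissible-spec : ∀ y → Truth (Admissible bs as i P y)
        (eval N admissible (codeNode (toℕ i) P ∷ codeFin y ∷ codeℕ m ∷ codePerms bs ∷ codePerms as ∷ []))
      admissible-spec y with eval N countdown (codeℕ m ∷ []) | countdown-eval {N} m (m≤N m²<N)
      ... | _ | refl = branch-Found (extendable-spec m²<N bs bs≤N ((i , y) ∷ P) P<N)
        (λ ¬ext → none (¬ext ∘ proj₁))
        (λ ext → branch-Found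
          (findFirst-spec
            {h = λ t _ → branch (eval N drop (codeFin y ∷ t ∷ [])) nil λ _ _ →
              eval N extendable (codePerms as ∷ ((codeFin y • t) • codePairs (map diagonal P)) ∷ [])}
            (reverse (allFin m)) (subst (_≤ N) (sym (length-reverse (allFin m))) length-allFin≤N) λ {z} _ _ →
            branch-Found {Z′ = ¬ (z Fin.< y × Extendable as ((y , z) ∷ map diagonal P))}
                         {Q′ = λ _ → z Fin.< y × Extendable as ((y , z) ∷ map diagonal P)}
              (monus-spec (toℕ y) (toℕ z) (toℕ≤N m²<N z))
              (λ y≤z → none λ (z<y , _) → ≤⇒≯ y≤z z<y)
              (λ z<y → mapFound (λ ¬ext → ¬ext ∘ proj₂) (z<y ,_)
                (extendable-spec m²<N as as≤N ((y , z) ∷ map diagonal P)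
                  (subst (_< N) (sym (length-map diagonal P)) P<N))))
          (λ least → some (ext , λ z z<y ext′ → All.lookup least (reverse⁺ (∈-allFin z)) (z<y , ext′)))
          (λ found → none λ (_ , least) → let z , _ , z<y , ext′ = find found in least z z<y ext′))

    opaque
      unfolding expand

      expand-eval : ∀ rest →
        eval N expand (codeNode (toℕ i) P ∷ rest ∷ codeℕ m ∷ codePerms bs ∷ codePerms as ∷ []) ≡
        foldr _•_ rest (map (λ y → codeNode (suc (toℕ i)) ((i , y) ∷ P)) (children bs as i P))
      expand-eval rest with eval N countdown (codeℕ m ∷ []) | countdown-eval {N} m (m≤N m²<N)
      ... | _ | refl = begin
        foldTree N next (codeList (map codeFin (reverse (allFin m)))) rest
          ≡⟨ foldTree-reverse codeFin next N (allFin m) rest length-allFin≤N ⟩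
        foldr (λ y acc → next (codeFin y) acc) rest (allFin m)
          ≡⟨ foldr-filter-• (admissible? bs as i P) (admissible′ ∘ codeFin) (child′ ∘ codeFin)
               admissible-spec rest (allFin m) ⟩
        foldr _•_ rest (map (child′ ∘ codeFin) (children bs as i P))
          ≡⟨ cong (foldr _•_ rest) (map-cong (child-eval i P) (children bs as i P)) ⟩
        foldr _•_ rest (map (λ y → codeNode (suc (toℕ i)) ((i , y) ∷ P)) (children bs as i P)) ∎
        where
        open ≡-Reasoning
        node : Tree
        node = codeNode (toℕ i) P
        admissible′ child′ : Tree → Tree
        admissible′ y = eval N admissible (node ∷ y ∷ codeℕ m ∷ codePerms bs ∷ codePerms as ∷ [])
        child′ y = eval N child (node ∷ y ∷ [])
        next : Tree → Tree → Tree
        next y acc = branch (admissible′ y) acc λ _ _ → child′ y • acc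

  module _ (μ : Permutation′ m) (P : List (Pair m)) (P≤N : length P ≤ N)
           (μP : Maps μ P) (total : ∀ x → (x , μ ⟨$⟩ʳ x) ∈ P) where

    opaque
      unfolding image

      image-eval : ∀ x → eval N image (codePairs P ∷ codeFin x ∷ []) ≡ codeFin (μ ⟨$⟩ʳ x)
      image-eval x = from-search (findFirst-spec
        {h = λ t _ → branch t nil λ a b → branch (eval N equals (a ∷ codeFin x ∷ [])) nil λ _ _ → nil • b} P P≤N
        λ {p} _ _ → branch-Found (equalFin-spec m²<N (proj₁ p) x) none (λ eq → some (eq , refl)))
        where
        from-search : ∀ {t} → Found (All (λ p → proj₁ p ≢ x) P)
                                    (λ v → Any (λ p → proj₁ p ≡ x × v ≡ nil • codeFin (proj₂ p)) P) t →
                      branch t nil (λ _ y → y) ≡ codeFin (μ ⟨$⟩ʳ x)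
        from-search (none absent) = contradiction refl (All.lookup absent (total x))
        from-search (some found) with find found
        ... | _ , p∈P , refl , refl = cong codeFin (sym (μP p∈P))

    opaque
      unfolding preimage

      preimage-eval : ∀ y → eval N preimage (codePairs P ∷ codeFin y ∷ []) ≡ codeFin (μ ⟨$⟩ˡ y)
      preimage-eval y = from-search (findFirst-spec
        {h = λ t _ → branch t nil λ a b → branch (eval N equals (b ∷ codeFin y ∷ [])) nil λ _ _ → nil • a} P P≤N
        λ {p} _ _ → branch-Found (equalFin-spec m²<N (proj₂ p) y) none (λ eq → some (eq , refl)))
        where
        from-search : ∀ {t} → Found (All (λ p → proj₂ p ≢ y) P)
                                    (λ v → Any (λ p → proj₂ p ≡ y × v ≡ nil • codeFin (proj₁ p)) P) t →
                      branch t nil (λ _ x → x) ≡ codeFin (μ ⟨$⟩ˡ y)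
        from-search (none absent) = contradiction (inverseʳ μ) (All.lookup absent (total (μ ⟨$⟩ˡ y)))
        from-search (some found) with find found
        ... | _ , p∈P , refl , refl = cong codeFin (trans (sym (inverseˡ μ)) (cong (μ ⟨$⟩ˡ_) (μP p∈P)))

    opaque
      unfolding conjugated

      conjugated-eval : ∀ g → eval N conjugated (codePairs P ∷ codeℕ m ∷ codePerm g ∷ []) ≡ codePerm (conjugate μ g)
      conjugated-eval g with eval N countdown (codeℕ m ∷ []) | countdown-eval {N} m (m≤N m²<N)
      ... | _ | refl = begin
        foldTree N (λ x acc → h x • acc) (codeList (map codeFin (reverse (allFin m)))) nil
          ≡⟨ foldTree-reverse codeFin (λ x acc → h x • acc) N (allFin m) nil length-allFin≤N ⟩
        foldr (λ x acc → h (codeFin x) • acc) nil (allFin m)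
          ≡⟨ foldr-• (h ∘ codeFin) (allFin m) ⟩
        codeList (map (h ∘ codeFin) (allFin m))
          ≡⟨ cong codeList (map-tabulate {n = m} (λ i → i) (h ∘ codeFin)) ⟩
        codeList (tabulate {n = m} (h ∘ codeFin))
          ≡⟨ cong codeList (tabulate-cong {n = m} h≡) ⟩
        codePerm (conjugate μ g) ∎
        where
        open ≡-Reasoning
        h : Tree → Tree
        h x = eval N preimage (codePairs P ∷ eval N nth (codePerm g ∷ eval N image (codePairs P ∷ x ∷ []) ∷ []) ∷ [])
        h≡ : ∀ x → h (codeFin x) ≡ codeFin (conjugate μ g ⟨$⟩ʳ x)
        h≡ x = begin
          h (codeFin x)
            ≡⟨ cong (λ t → eval N preimage (codePairs P ∷ eval N nth (codePerm g ∷ t ∷ []) ∷ [])) (image-eval x) ⟩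
          eval N preimage (codePairs P ∷ eval N nth (codePerm g ∷ codeFin (μ ⟨$⟩ʳ x) ∷ []) ∷ [])
            ≡⟨ cong (λ t → eval N preimage (codePairs P ∷ t ∷ [])) (nth-eval (m≤N m²<N) g (μ ⟨$⟩ʳ x)) ⟩
          eval N preimage (codePairs P ∷ codeFin (g ⟨$⟩ʳ (μ ⟨$⟩ʳ x)) ∷ [])
            ≡⟨ preimage-eval (g ⟨$⟩ʳ (μ ⟨$⟩ʳ x)) ⟩
          codeFin (conjugate μ g ⟨$⟩ʳ x) ∎

    opaque
      unfolding result

      result-eval : ∀ i as → length as ≤ N →
        eval N result (codeNode i P ∷ codeℕ m ∷ codePerms as ∷ []) ≡ codePerms (map (conjugate μ) as)
      result-eval i as as≤N with eval N reversed (codePerms as ∷ []) | reversed-eval {N = N} codePerm as as≤N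
      ... | _ | refl = begin
        foldTree N (λ g acc → h g • acc) (codeList (map codePerm (reverse as))) nil
          ≡⟨ foldTree-reverse codePerm (λ g acc → h g • acc) N as nil as≤N ⟩
        foldr (λ g acc → h (codePerm g) • acc) nil as
          ≡⟨ foldr-• (h ∘ codePerm) as ⟩
        codeList (map (h ∘ codePerm) as)
          ≡⟨ cong codeList (map-cong conjugated-eval as) ⟩
        codeList (map (codePerm ∘ conjugate μ) as)
          ≡⟨ cong codeList (map-∘ as) ⟩
        codePerms (map (conjugate μ) as) ∎
        where
        open ≡-Reasoning
        h : Tree → Tree
        h g = eval N conjugated (codePairs P ∷ codeℕ m ∷ g ∷ [])

-- Leaves of the search tree

codeℕ-injective : ∀ {a b} → codeℕ a ≡ codeℕ b → a ≡ b
codeℕ-injective {zero}  {zero}  _  = refl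
codeℕ-injective {suc a} {suc b} eq = cong suc (codeℕ-injective (right eq))
  where
  right : ∀ {x y x′ y′} → x • y ≡ x′ • y′ → y ≡ y′
  right refl = refl

•-injective : ∀ {x y x′ y′} → x • y ≡ x′ • y′ → x ≡ x′ × y ≡ y′
•-injective refl = refl , refl

codeList-tabulate-injective : ∀ {m} {f g : Fin m → Tree} →
  codeList (tabulate f) ≡ codeList (tabulate g) → ∀ i → f i ≡ g i
codeList-tabulate-injective eq zero    = proj₁ (•-injective eq)
codeList-tabulate-injective eq (suc i) = codeList-tabulate-injective (proj₂ (•-injective eq)) i

codePerm-injective : ∀ {m} {π ρ : Permutation′ m} → codePerm π ≡ codePerm ρ → π ≈ₚ ρ
codePerm-injective eq i = Fin.toℕ-injective (codeℕ-injective (codeList-tabulate-injective eq i))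

codePerms-map-injective : ∀ {m} {A : Set} {f g : A → Permutation′ m} as →
  codePerms (map f as) ≡ codePerms (map g as) → ∀ {a} → a ∈ as → f a ≈ₚ g a
codePerms-map-injective {f = f} {g} (a ∷ as) eq (here refl) =
  codePerm-injective {π = f a} {g a} (proj₁ (•-injective eq))
codePerms-map-injective (a ∷ as) eq (there a∈as) = codePerms-map-injective as (proj₂ (•-injective eq)) a∈as

least : ∀ {m} {P : Fin m → Set} → (∀ x → Dec (P x)) → ∀ y → P y → ∃[ z ] (P z × (∀ w → w Fin.< z → ¬ P w))
least {P = P} P? y py = go y py (FinInduction.<-wellFounded y)
  where
  go : ∀ y → P y → Acc Fin._<_ y → ∃[ z ] (P z × (∀ w → w Fin.< z → ¬ P w))
  go y py (WellFounded.acc rs) with Fin.any? (λ w → (w Fin.<? y) ×-dec P? w)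
  ... | yes (w , w<y , pw) = go w pw (rs w<y)
  ... | no  none′          = y , py , λ w w<y pw → none′ (w , w<y , pw)

Unique⇒AllPairs : ∀ {A : Set} {R : A → A → Set} {xs} → Unique xs →
                  (∀ {x y} → x ∈ xs → y ∈ xs → x ≢ y → R x y) → AllPairs R xs
Unique⇒AllPairs []       r = []
Unique⇒AllPairs (x∉ ∷ u) r =
  All.tabulate (λ y∈ → r (here refl) (there y∈) (All.lookup x∉ y∈)) ∷
  Unique⇒AllPairs u λ x∈ y∈ → r (there x∈) (there y∈)

position : ∀ {m} i h → i + suc h ≡ m → Fin m
position i h eq = fromℕ< (subst (i <_) eq (m<m+n i z<s))

toℕ-position : ∀ {m} i h (eq : i + suc h ≡ m) → toℕ (position i h eq) ≡ i
toℕ-position i h eq = Fin.toℕ-fromℕ< _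

next : ∀ {m} i h → i + suc h ≡ m → suc i + h ≡ m
next i h eq = trans (sym (+-suc i h)) eq

module _ {m : ℕ} (bs as : List (Permutation′ m)) where

  -- The recursion is on the height `h` of the subtree; `i + h ≡ m` turns `i` into a point of
  -- `Fin m` when the height is positive.
  leaves : ∀ h i → i + h ≡ m → List (Pair m) → List (List (Pair m))
  leaves zero    i eq P = P ∷ []
  leaves (suc h) i eq P =
    concatMap (λ y → leaves h (suc i) (next i h eq) ((position i h eq , y) ∷ P))
              (children bs as (position i h eq) P)

  leaf⁻ : ∀ h {i eq P Q} → Q ∈ leaves (suc h) i eq P → ∃[ y ] (y ∈ children bs as (position i h eq) P ×
          Q ∈ leaves h (suc i) (next i h eq) ((position i h eq , y) ∷ P))
  leaf⁻ h {i} {eq} {P} Q∈ =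
    find (∈-concatMap⁻ (λ y → leaves h (suc i) (next i h eq) ((position i h eq , y) ∷ P))
                       {xs = children bs as (position i h eq) P} Q∈)

  Covers : ℕ → List (Pair m) → Set
  Covers i P = ∀ x → toℕ x < i → ∃[ y ] (x , y) ∈ P

  Covers-∷ : ∀ {i h P y} (eq : i + suc h ≡ m) → Covers i P → Covers (suc i) ((position i h eq , y) ∷ P)
  Covers-∷ {i} {h} {y = y} eq covers x x<1+i with toℕ x ≟ i
  ... | yes x≡i = y , here (cong (_, y) (Fin.toℕ-injective (trans x≡i (sym (toℕ-position i h eq)))))
  ... | no  x≢i = let y′ , ∈P = covers x (≤∧≢⇒< (≤-pred x<1+i) x≢i) in y′ , there ∈P

  record IsNode (i : ℕ) (P : List (Pair m)) : Set where
    field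
      extends : Extendable bs P
      covers  : Covers i P
      size    : length P ≡ i

  open IsNode

  root-isNode : IsNode 0 []
  root-isNode = record { extends = idₚ , (λ _ _ → refl) , (λ ()) ; covers = λ _ () ; size = refl }

  child-isNode : ∀ {i h P y} (eq : i + suc h ≡ m) → IsNode i P → y ∈ children bs as (position i h eq) P →
                 IsNode (suc i) ((position i h eq , y) ∷ P)
  child-isNode {i} {h} {P} eq node y∈ = record
    { extends = proj₁ (proj₂ (∈-filter⁻ (admissible? bs as (position i h eq) P) {xs = allFin m} y∈))
    ; covers  = Covers-∷ eq (covers node)
    ; size    = cong suc (size node)
    }

  leaf-⊆ : ∀ h {i} {eq : i + h ≡ m} {P Q} → Q ∈ leaves h i eq P → ∀ {p} → p ∈ P → p ∈ Q
  leaf-⊆ zero    (here refl) p∈P = p∈P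
  leaf-⊆ (suc h) {i} {eq} Q∈ p∈P = let _ , _ , Q∈′ = leaf⁻ h {i} {eq} Q∈ in leaf-⊆ h {suc i} Q∈′ (there p∈P)

  leaf-isNode : ∀ h {i eq P Q} → IsNode i P → Q ∈ leaves h i eq P → IsNode m Q
  leaf-isNode zero    {i} {eq} node (here refl) = subst (λ i → IsNode i _) (trans (sym (+-identityʳ i)) eq) node
  leaf-isNode (suc h) {i} {eq} node Q∈ =
    let _ , y∈ , Q∈′ = leaf⁻ h {i} {eq} Q∈ in leaf-isNode h {suc i} (child-isNode {i} eq node y∈) Q∈′

  leaf-total : ∀ {Q μ} → IsNode m Q → Maps μ Q → ∀ x → (x , μ ⟨$⟩ʳ x) ∈ Q
  leaf-total node μQ x =
    let y , ∈Q = covers node x (Fin.toℕ<n x) in subst (λ z → (x , z) ∈ _) (sym (μQ ∈Q)) ∈Q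

  module _ (C-as⊆C-bs : ∀ {κ} → Commutes κ as → Commutes κ bs) where

    -- Replaces μ by an element of its coset that sends k to an admissible point.
    admissible-child : ∀ k P μ → Commutes μ bs → Maps μ P →
      ∃[ z ] ∃[ κ ] (z ∈ children bs as k P × Commutes κ as × Commutes (μ ∘ₚ κ) bs × Maps (μ ∘ₚ κ) ((k , z) ∷ P))
    admissible-child k P μ μbs μP =
      let y = μ ⟨$⟩ʳ k
          -- `z` is the least point in the orbit of `y` under the stabilizer, and `κ` carries `y` to
          -- it.
          z , (κ , κas , κD) , z-least =
            least (λ z → extendable? as ((y , z) ∷ map diagonal P)) y
              (idₚ , (λ _ _ → refl) , λ { (here refl) → refl ; (there ∈D) → id-diagonal ∈D })
          μκbs : Commutes (μ ∘ₚ κ) bs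
          μκbs g∈bs x = trans (cong (κ ⟨$⟩ʳ_) (μbs g∈bs x)) (C-as⊆C-bs {κ} κas g∈bs (μ ⟨$⟩ʳ x))
          μκP : Maps (μ ∘ₚ κ) ((k , z) ∷ P)
          μκP = λ { (here refl) → κD (here refl)
                  ; (there xy∈P) → trans (cong (κ ⟨$⟩ʳ_) (μP xy∈P)) (κD (there (∈-map⁺ diagonal xy∈P))) }
      in z , κ
       , ∈-filter⁺ (admissible? bs as k P) (∈-allFin z)
           ( (μ ∘ₚ κ , μκbs , μκP)
           -- An element of the stabilizer that moves `z` to a smaller `w` would, after `κ`, move
           -- `y` there too.
           , λ w w<z (κ′ , κ′as , κ′D) → z-least w w<z
               ( κ ∘ₚ κ′
               , (λ g∈as x → trans (cong (κ′ ⟨$⟩ʳ_) (κas g∈as x)) (κ′as g∈as (κ ⟨$⟩ʳ x)))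
               , λ { (here refl) → trans (cong (κ′ ⟨$⟩ʳ_) (κD (here refl))) (κ′D (here refl))
                   ; (there ∈D)  → trans (cong (κ′ ⟨$⟩ʳ_) (κD (there ∈D))) (fixes κ′ (λ ∈D′ → κ′D (there ∈D′)) ∈D) }))
       , κas , μκbs , μκP
      where
      id-diagonal : Maps idₚ (map diagonal P)
      id-diagonal ∈D with ∈-map⁻ diagonal ∈D
      ... | _ , _ , refl = refl
      fixes : ∀ κ′ → Maps κ′ (map diagonal P) → ∀ {x y} → (x , y) ∈ map diagonal P → κ′ ⟨$⟩ʳ y ≡ y
      fixes κ′ κ′D ∈D with ∈-map⁻ diagonal ∈D
      ... | _ , _ , refl = κ′D ∈D

    -- Each level corrects `μ` by an element that commutes with `as`. The product of the corrections
    -- still does, so the leaf found represents the coset of the original `μ`.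
    leaves-complete : ∀ h i eq P μ → Commutes μ bs → Maps μ P →
      ∃[ Q ] ∃[ κ ] (Q ∈ leaves h i eq P × Commutes κ as × Maps (μ ∘ₚ κ) Q)
    leaves-complete zero    i eq P μ μbs μP = P , idₚ , here refl , (λ _ _ → refl) , μP
    leaves-complete (suc h) i eq P μ μbs μP =
      let z , κ , z∈ , κas , μκbs , μκP = admissible-child (position i h eq) P μ μbs μP
          Q , κ′ , Q∈ , κ′as , μκκ′Q = leaves-complete h (suc i) _ _ (μ ∘ₚ κ) μκbs μκP
      in Q , κ ∘ₚ κ′ , ∈-concatMap⁺ (λ y → leaves h (suc i) (next i h eq) ((position i h eq , y) ∷ P)) (lose z∈ Q∈)
       , (λ g∈as x → trans (cong (κ′ ⟨$⟩ʳ_) (κas g∈as x)) (κ′as g∈as (κ ⟨$⟩ʳ x)))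
       , μκκ′Q

  same-conjugates⇒Commutes : ∀ {μ ν} → (∀ {g} → g ∈ as → conjugate μ g ≈ₚ conjugate ν g) → Commutes (flip μ ∘ₚ ν) as
  same-conjugates⇒Commutes {μ} {ν} same {g} g∈as u = begin
    ν ⟨$⟩ʳ (μ ⟨$⟩ˡ (g ⟨$⟩ʳ u))                       ≡⟨ cong (λ v → ν ⟨$⟩ʳ (μ ⟨$⟩ˡ (g ⟨$⟩ʳ v))) (inverseʳ μ) ⟨
    ν ⟨$⟩ʳ (conjugate μ g ⟨$⟩ʳ (μ ⟨$⟩ˡ u))           ≡⟨ cong (ν ⟨$⟩ʳ_) (same g∈as (μ ⟨$⟩ˡ u)) ⟩
    ν ⟨$⟩ʳ (ν ⟨$⟩ˡ (g ⟨$⟩ʳ (ν ⟨$⟩ʳ (μ ⟨$⟩ˡ u))))     ≡⟨ inverseʳ ν ⟩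
    g ⟨$⟩ʳ (ν ⟨$⟩ʳ (μ ⟨$⟩ˡ u))                       ∎
    where open ≡-Reasoning

  -- If leaves below two siblings had the same output, `flip μ ∘ₚ ν` would lie in the stabilizer and
  -- carry one sibling's value to the other's, so the larger value would not be least in its orbit.
  conjugates-separate : ∀ {k y z P μ ν} → Maps μ ((k , y) ∷ P) → Maps ν ((k , z) ∷ P) →
    (∀ {g} → g ∈ as → conjugate μ g ≈ₚ conjugate ν g) → Extendable as ((y , z) ∷ map diagonal P)
  conjugates-separate {P = P} {μ} {ν} μP νP same =
    flip μ ∘ₚ ν , same-conjugates⇒Commutes {μ} {ν} same , λ where
      (here refl) → moves (μP (here refl)) (νP (here refl))
      (there ∈D)  → moves-diagonal (∈-map⁻ diagonal ∈D)
    where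
    moves : ∀ {x y z} → μ ⟨$⟩ʳ x ≡ y → ν ⟨$⟩ʳ x ≡ z → ν ⟨$⟩ʳ (μ ⟨$⟩ˡ y) ≡ z
    moves refl refl = cong (ν ⟨$⟩ʳ_) (inverseˡ μ)
    moves-diagonal : ∀ {x y} → ∃[ p ] (p ∈ P × (x , y) ≡ diagonal p) → ν ⟨$⟩ʳ (μ ⟨$⟩ˡ x) ≡ y
    moves-diagonal (_ , p∈P , refl) = moves (μP (there p∈P)) (νP (there p∈P))

  module _ (output : List (Pair m) → Tree)
           (output≡ : ∀ {Q μ} → IsNode m Q → Maps μ Q → output Q ≡ codePerms (map (conjugate μ) as)) where

    children-disjoint : ∀ h {k i eq P y z} → IsNode i ((k , y) ∷ P) → IsNode i ((k , z) ∷ P) →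
      Admissible bs as k P y → z Fin.< y →
      Disjoint (map output (leaves h i eq ((k , y) ∷ P))) (map output (leaves h i eq ((k , z) ∷ P)))
    children-disjoint h {i = i} {eq} node node′ (_ , y-least) z<y (t∈ , t∈′) =
      let Q , Q∈ , t≡ = ∈-map⁻ output t∈
          Q′ , Q′∈ , t≡′ = ∈-map⁻ output t∈′
          leaf = leaf-isNode h {i} {eq} node Q∈
          leaf′ = leaf-isNode h {i} {eq} node′ Q′∈
          μ , _ , μQ = extends leaf
          ν , _ , νQ = extends leaf′
      in y-least _ z<y (conjugates-separate {μ = μ} {ν}
           (λ p∈ → μQ (leaf-⊆ h {i} {eq} Q∈ p∈)) (λ p∈ → νQ (leaf-⊆ h {i} {eq} Q′∈ p∈))
           (codePerms-map-injective as (trans (sym (output≡ {μ = μ} leaf μQ))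
             (trans (sym t≡) (trans t≡′ (output≡ {μ = ν} leaf′ νQ))))))

    outputs-unique : ∀ h i eq P → IsNode i P → Unique (map output (leaves h i eq P))
    outputs-unique zero    i eq P node = [] ∷ []
    outputs-unique (suc h) i eq P node = subst Unique (sym (map-concatMap output subleaves ys))
      (Unique.concat⁺
        (All.map⁺ (All.tabulate λ y∈ → outputs-unique h (suc i) _ _ (child-isNode eq node y∈)))
        (AllPairs.map⁺ (Unique⇒AllPairs (Unique.filter⁺ (admissible? bs as k P) (Unique.allFin⁺ m)) disjoint)))
      where
      k = position i h eq
      ys = children bs as k P
      subleaves : Fin m → List (List (Pair m))
      subleaves y = leaves h (suc i) (next i h eq) ((k , y) ∷ P)
      admissible-∈ : ∀ {y} → y ∈ ys → Admissible bs as k P y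
      admissible-∈ y∈ = proj₂ (∈-filter⁻ (admissible? bs as k P) {xs = allFin m} y∈)
      disjoint : ∀ {y z} → y ∈ ys → z ∈ ys → y ≢ z → Disjoint (map output (subleaves y)) (map output (subleaves z))
      disjoint {y} {z} y∈ z∈ y≢z with Fin.<-cmp y z
      -- The admissibility contradicted is always that of the larger value, so the two sides are
      -- exchanged here.
      ... | tri< y<z _ _ = λ (t∈ , t∈′) →
        children-disjoint h (child-isNode eq node z∈) (child-isNode eq node y∈) (admissible-∈ z∈) y<z (t∈′ , t∈)
      ... | tri≈ _ y≡z _ = contradiction y≡z y≢z
      ... | tri> _ _ z<y =
        children-disjoint h (child-isNode eq node y∈) (child-isNode eq node z∈) (admissible-∈ y∈) z<y

-- The enumeration

outputs-ticks : ∀ k t → outputs (ticks k ++ t) ≡ outputs t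
outputs-ticks zero    t = refl
outputs-ticks (suc k) t = outputs-ticks k t

costs-ticks : ∀ j k t → marginalCostsFrom j (ticks k ++ t) ≡ marginalCostsFrom (j + k) t
costs-ticks j zero    t = cong (λ l → marginalCostsFrom l t) (sym (+-identityʳ j))
costs-ticks j (suc k) t = trans (costs-ticks (suc j) k t) (cong (λ l → marginalCostsFrom l t) (sym (+-suc j k)))

ticks-++ : ∀ k l t → ticks k ++ (ticks l ++ t) ≡ ticks (k + l) ++ t
ticks-++ k l t = trans (sym (++-assoc (ticks k) (ticks l) t)) (cong (_++ t) (ticks-+ k l))

-- Generalizes `Runs` to traces whose initial ticks are followed by a part `t` that may contain
-- outputs.
Delayed : ∀ {k} → Vec Tree k → Program k → Tree → ℕ → Trace → Set
Delayed ρ p v B t = ∃[ k ] (k ≤ B × ρ ⊢ p ⇓ v ∣ ticks k ++ t)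

module _ {k} {ρ : Vec Tree k} where

  delayed-let : ∀ {a b u v A B t} → Runs ρ a u A → Delayed (u ∷ ρ) b v B t →
                Delayed ρ (let′ a b) v (1 + (A + B)) t
  delayed-let {t = t} (i , i≤ , p) (j , j≤ , q) =
    suc (i + j) , s≤s (+-mono-≤ i≤ j≤) ,
    subst (λ t → ρ ⊢ _ ⇓ _ ∣ tick ∷ t) (ticks-++ i j t) (let′ p q)

  delayed-case-nil : ∀ {e a b v A B t} → Runs ρ e nil A → Delayed ρ a v B t →
                     Delayed ρ (case e a b) v (1 + (A + B)) t
  delayed-case-nil {t = t} (i , i≤ , p) (j , j≤ , q) =
    suc (i + j) , s≤s (+-mono-≤ i≤ j≤) ,
    subst (λ t → ρ ⊢ _ ⇓ _ ∣ tick ∷ t) (ticks-++ i j t) (case-nil p q)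

  delayed-case-cons : ∀ {e a b x y v A B t} → Runs ρ e (x • y) A → Delayed (x ∷ y ∷ ρ) b v B t →
                      Delayed ρ (case e a b) v (1 + (A + B)) t
  delayed-case-cons {t = t} (i , i≤ , p) (j , j≤ , q) =
    suc (i + j) , s≤s (+-mono-≤ i≤ j≤) ,
    subst (λ t → ρ ⊢ _ ⇓ _ ∣ tick ∷ t) (ticks-++ i j t) (case-cons p q)

  delayed-while : ∀ {e s b u v A t} → Runs ρ e u A → ρ ⊢[ s , b ] u ⇓ v ∣ t →
                  Delayed ρ (while e s b) v (1 + A) t
  delayed-while (i , i≤ , p) q = suc i , s≤s i≤ , while p q

  delayed-emit : ∀ {e o A} → Runs ρ e o A → Delayed ρ (emit e) nil (1 + A) (out o ∷ [])
  delayed-emit (i , i≤ , p) = suc i , s≤s i≤ , emit p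

  delayed-emit-let : ∀ {a b u v A B o} → Delayed ρ a u A (out o ∷ []) → Runs (u ∷ ρ) b v B →
                     ∃[ l ] (l ≤ B × Delayed ρ (let′ a b) v (1 + A) (out o ∷ ticks l))
  delayed-emit-let {o = o} (i , i≤ , p) (l , l≤ , q) = l , l≤ , suc i , s≤s i≤ ,
    subst (λ t → ρ ⊢ _ ⇓ _ ∣ tick ∷ t) (++-assoc (ticks i) (out o ∷ []) (ticks l)) (let′ p q)

-- The search program and its runs

opaque

  -- The clock is bootstrapped: this expression is run with the code of n as its clock, and
  -- `clockSquare` with the result of this one.
  clockBase : Expr 2
  clockBase = fold (var 0F) (cons nil (var 1F)) (cons nil (cons nil (var 1F)))

  clockBase-eval : ∀ n m → eval n clockBase (codeℕ n ∷ codeℕ m ∷ []) ≡ codeℕ (n * 2 + suc m)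
  clockBase-eval n m = go n (suc m)
    where
    go : ∀ k a → foldTree k (λ _ acc → nil • (nil • acc)) (codeℕ k) (codeℕ a) ≡ codeℕ (k * 2 + a)
    go zero    a = refl
    go (suc k) a = trans (go k (2 + a)) (cong codeℕ (trans (+-suc (k * 2) (suc a)) (cong suc (+-suc (k * 2) a))))

opaque

  clockSquare : Expr 0
  clockSquare = fold clock nil (fold clock (var 1F) (cons nil (var 1F)))

  clockSquare-eval : ∀ s → eval s clockSquare [] ≡ codeℕ (s * s)
  clockSquare-eval s = trans (go s 0) (cong codeℕ (+-identityʳ (s * s)))
    where
    add : ∀ k a → foldTree k (λ _ acc → nil • acc) (codeℕ k) (codeℕ a) ≡ codeℕ (k + a)
    add zero    a = refl
    add (suc k) a = trans (add k (suc a)) (cong codeℕ (+-suc k a))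
    go : ∀ k a → foldTree k (λ _ acc → foldTree s (λ _ acc → nil • acc) (codeℕ s) acc) (codeℕ k) (codeℕ a) ≡
                 codeℕ (k * s + a)
    go zero    a = refl
    go (suc k) a = trans (cong (foldTree k _ (codeℕ k)) (add s a))
      (trans (go k (s + a)) (cong codeℕ (trans (sym (+-assoc (k * s) s a)) (cong (_+ a) (+-comm (k * s) s)))))

-- The loop state is the stack of pending nodes. A complete node is output and popped; any other is
-- replaced by its children.
searchBody : Program 14
searchBody =
  case (var 0F) nil
    (case (compile (Vec.lookup (0F ∷ # 11 ∷ [])) 3F unfinished)
      (let′ (emit (compile (Vec.lookup (0F ∷ # 11 ∷ 6F ∷ [])) 3F result)) (var 2F))
      (compile (Vec.lookup (2F ∷ 3F ∷ # 13 ∷ 9F ∷ 8F ∷ [])) 5F expand))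

-- The case distinctions bind the components of the input, the bindings the clock.
search : Program 1
search =
  case (var 0F) nil (case (var 1F) nil (case (var 1F) nil (case (var 1F) nil (case (var 1F) nil
    (let′ (compile (Vec.lookup (8F ∷ 6F ∷ [])) 8F clockBase)
      (let′ (compile (Vec.lookup []) 0F clockSquare)
        -- The initial stack holds just the root, the code of the empty map.
        (while (cons (cons nil (cons nil nil)) nil) (var 0F) searchBody)))))))

-- Covers both kinds of round: the overhead is 5 ticks for an inner node and 7 for a leaf up to its
-- output.
iterationCost : ℕ → ℕ
iterationCost N = 10 + (cost N unfinished + (cost N result + cost N expand))

leafOutput : ∀ {m} → ℕ → List (Permutation′ m) → List (Pair m) → Tree
leafOutput {m} N as Q = eval N result (codeNode m Q ∷ codeℕ m ∷ codePerms as ∷ [])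

leafOutput≡ : ∀ {N m} → m * m < N → (bs as : List (Permutation′ m)) → length as ≤ N →
              ∀ {Q μ} → IsNode bs as m Q → Maps μ Q → leafOutput N as Q ≡ codePerms (map (conjugate μ) as)
leafOutput≡ {m = m} m²<N bs as as≤N {Q} {μ} node μQ =
  result-eval m²<N μ Q (≤-trans (≤-reflexive (IsNode.size node)) (m≤N m²<N))
    μQ (leaf-total bs as {μ = μ} node μQ) m as as≤N

module _ {N m : ℕ} (m²<N : m * m < N) (bs as : List (Permutation′ m)) (bs≤N : length bs ≤ N) (as≤N : length as ≤ N)
         (C-as⊆C-bs : ∀ {κ} → Commutes κ as → Commutes κ bs)
         {s gG r₄ gM r₃ r₂ cn r₁ input : Tree} where

  environment : Vec Tree 13
  environment = codeℕ N ∷ s ∷ gG ∷ codePerms as ∷ codePerms bs ∷ r₄ ∷ gM ∷ r₃ ∷ codeℕ m ∷ r₂ ∷ cn ∷ r₁ ∷ input ∷ []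

  private
    c = iterationCost N
    -- Bounds the cost from any stack to the next output.
    F = suc m * c

  -- `f` bounds the ticks from the stack `S` to the next output or the halt, and `c + F` the later
  -- gaps. Counting from `k` ticks already spent allows silent rounds to be chained.
  SearchRuns : ℕ → Tree → List Tree → Set
  SearchRuns f S outs = ∃[ v ] ∃[ t ] (environment ⊢[ var 0F , searchBody ] S ⇓ v ∣ t × outputs t ≡ outs ×
    (∀ k {B} → k + f ≤ B → c + F ≤ B → All (_≤ B) (marginalCostsFrom k t)))

  weaken : ∀ {f f′ S outs} → f ≤ f′ → SearchRuns f S outs → SearchRuns f′ S outs
  weaken f≤f′ (v , t , run , outs≡ , costs) = v , t , run , outs≡ , λ k ≤B → costs k (≤-trans (+-monoʳ-≤ k f≤f′) ≤B)

  2≤c : 2 ≤ c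
  2≤c = s≤s (s≤s z≤n)

  search-empty : SearchRuns c nil []
  search-empty = nil , ticks 2 , stop (var 0F) , refl , λ k {B} ≤B _ →
    subst (_≤ B) (+-comm k 2) (≤-trans (+-monoʳ-≤ k 2≤c) ≤B) ∷ []

  unfinished-runs : ∀ i h (P : List (Pair m)) S → i + h ≡ m →
    Runs (codeNode i P ∷ S ∷ (codeNode i P • S) ∷ environment)
         (compile (Vec.lookup (0F ∷ # 11 ∷ [])) 3F unfinished) (codeℕ h) (cost N unfinished)
  unfinished-runs i h P S eq = subst (λ t → Runs ρ _ t _) (trans (unfinished-eval {m = m} i i≤N) (cong codeℕ m∸i≡h))
    (compile-runs unfinished {σ = codeNode i P ∷ codeℕ m ∷ []} {ρ} refl λ { 0F → refl ; 1F → refl })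
    where
    ρ : Vec Tree 16
    ρ = codeNode i P ∷ S ∷ (codeNode i P • S) ∷ environment
    i≤N : i ≤ N
    i≤N = ≤-trans (≤-trans (m≤m+n i h) (≤-reflexive eq)) (m≤N m²<N)
    m∸i≡h : m ∸ i ≡ h
    m∸i≡h = trans (cong (_∸ i) (sym eq)) (m+n∸m≡n i h)

  search-inner : ∀ {f outs} i h (P : List (Pair m)) S → i + suc h ≡ m →
    SearchRuns f (eval N expand (codeNode i P ∷ S ∷ codeℕ m ∷ codePerms bs ∷ codePerms as ∷ [])) outs →
    SearchRuns (c + f) (codeNode i P • S) outs
  search-inner {f} i h P S eq (v , t , run , outs≡ , costs) =
    let j , j≤ , body = body-runs
    in v , ticks 2 ++ (ticks j ++ t) , step (var 0F) body run
     , trans (outputs-ticks j t) outs≡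
     , λ k {B} ≤B c+F≤B → subst (All (_≤ B)) (sym (costs-ticks (2 + k) j t)) (costs (2 + k + j)
         (≤-trans (≤-trans (≤-reflexive (shift k j f)) (+-monoʳ-≤ k (+-monoˡ-≤ f (cost≤ j≤)))) ≤B) c+F≤B)
    where
    body-runs : Runs ((codeNode i P • S) ∷ environment) searchBody
      (eval N expand (codeNode i P ∷ S ∷ codeℕ m ∷ codePerms bs ∷ codePerms as ∷ [])) _
    body-runs = runs-case-cons (runs-var 0F) (runs-case-cons (unfinished-runs i (suc h) P S eq)
      (compile-runs expand {σ = codeNode i P ∷ S ∷ codeℕ m ∷ codePerms bs ∷ codePerms as ∷ []} refl
        λ { 0F → refl ; 1F → refl ; 2F → refl ; 3F → refl ; 4F → refl }))
    shift : ∀ k j f → 2 + k + j + f ≡ k + (2 + j + f)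
    shift k j f = trans (cong (λ l → 2 + l) (+-assoc k j f))
      (sym (trans (+-suc k (suc (j + f))) (cong suc (+-suc k (j + f)))))
    cost≤ : ∀ {j} → j ≤ 3 + (cost N unfinished + cost N expand) → 2 + j ≤ c
    cost≤ j≤ = ≤-trans (+-monoʳ-≤ 2 j≤) (+-mono-≤ (m≤n+m 5 5) (+-monoʳ-≤ (cost N unfinished) (m≤n+m _ (cost N result))))

  search-leaf : ∀ {outs} (P : List (Pair m)) S → SearchRuns F S outs →
                SearchRuns c (codeNode m P • S) (leafOutput N as P ∷ outs)
  search-leaf P S (v , t , run , outs≡ , costs) =
    let l , l≤ , emitting = delayed-emit-let {B = 1} (delayed-emit result-runs) (runs-var 2F)
        j , j≤ , body = delayed-case-cons {ρ = (codeNode m P • S) ∷ environment} (runs-var 0F)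
                          (delayed-case-nil (unfinished-runs m 0 P S (+-identityʳ m)) emitting)
        trace≡ = ++-assoc (ticks j) (out (leafOutput N as P) ∷ ticks l) t
    in v , ticks 2 ++ ((ticks j ++ (out (leafOutput N as P) ∷ ticks l)) ++ t) , step (var 0F) body run
     , trans (cong outputs trace≡) (trans (outputs-ticks j (out (leafOutput N as P) ∷ (ticks l ++ t)))
         (cong (leafOutput N as P ∷_) (trans (outputs-ticks l t) outs≡)))
     , λ k {B} ≤B c+F≤B → subst (All (_≤ B))
         (sym (trans (cong (marginalCostsFrom (2 + k)) trace≡)
           (costs-ticks (2 + k) j (out (leafOutput N as P) ∷ (ticks l ++ t)))))
         ( ≤-trans (≤-trans (≤-reflexive (shift k j)) (+-monoʳ-≤ k (cost≤ j≤))) ≤B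
         -- The output resets the count. What is left of the round is at most one tick, for which
         -- the `c` in `c + F` makes room.
         ∷ subst (All (_≤ B)) (sym (costs-ticks 0 l t))
             (costs l (≤-trans (+-monoˡ-≤ F {l} {c} (≤-trans l≤ (s≤s z≤n))) c+F≤B) c+F≤B))
    where
    result-runs : Runs (codeNode m P ∷ S ∷ (codeNode m P • S) ∷ environment)
      (compile (Vec.lookup (0F ∷ # 11 ∷ 6F ∷ [])) 3F result) (leafOutput N as P) (cost N result)
    result-runs = compile-runs result {σ = codeNode m P ∷ codeℕ m ∷ codePerms as ∷ []} refl
      λ { 0F → refl ; 1F → refl ; 2F → refl }
    shift : ∀ k j → 2 + k + j ≡ k + (2 + j)
    shift k j = sym (trans (+-suc k (suc j)) (cong suc (+-suc k j)))
    cost≤ : ∀ {j} → j ≤ 3 + (cost N unfinished + (2 + cost N result)) → 2 + j ≤ c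
    cost≤ {j} j≤ = begin
      2 + j                         ≤⟨ +-monoʳ-≤ 2 j≤ ⟩
      5 + (u + (2 + r))             ≡⟨ cong (5 +_) (trans (+-suc u (suc r)) (cong suc (+-suc u r))) ⟩
      7 + (u + r)                   ≤⟨ +-mono-≤ (m≤n+m 7 3) (+-monoʳ-≤ u (m≤m+n r (cost N expand))) ⟩
      10 + (u + (r + cost N expand)) ∎
      where
      open ≤-Reasoning
      u = cost N unfinished
      r = cost N result

  -- The absence of dead ends: the map of a node extends to some `μ` commuting with `bs`, and the
  -- coset of `μ` contains an element with an admissible next value.
  children-nonempty : ∀ i h eq P → IsNode bs as i P → children bs as (position {m} i h eq) P ≢ []
  children-nonempty i h eq P node none′ =
    let μ , μbs , μP = IsNode.extends node
        z , _ , z∈ , _ = admissible-child bs as (λ {κ} → C-as⊆C-bs {κ}) (position i h eq) P μ μbs μP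
    in contradiction (subst (z ∈_) none′ z∈) λ ()

  -- The first output comes after h + 1 rounds, one for each level down to the first leaf. The stack
  -- below is reached only after an output, when the count has restarted.
  search-node : ∀ h i (eq : i + h ≡ m) P S {outs} → IsNode bs as i P → SearchRuns F S outs →
                SearchRuns (suc h * c) (codeNode i P • S) (map (leafOutput N as) (leaves bs as h i eq P) ++ outs)
  search-node zero    i eq P S {outs} node rest =
    weaken (m≤m+n c 0)
      (subst (λ i → SearchRuns c (codeNode i P • S) (leafOutput N as P ∷ outs))
        (sym (trans (sym (+-identityʳ i)) eq)) (search-leaf P S rest))
  search-node (suc h) i eq P S {outs} node rest =
    search-inner i h P S eq (subst₂ (SearchRuns (suc h * c)) (sym expanded)
      (cong (_++ outs) (sym (map-concatMap (leafOutput N as) subleaves ys)))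
      (nonempty-forest ys (λ y∈ → y∈) (children-nonempty i h eq P node)))
    where
    k = position i h eq
    ys = children bs as k P
    subleaves : Fin m → List (List (Pair m))
    subleaves y = leaves bs as h (suc i) (next i h eq) ((k , y) ∷ P)
    childNode : Fin m → Tree
    childNode y = codeNode (suc i) ((k , y) ∷ P)
    P<N : length P < N
    P<N = ≤-trans (subst (length P <_) eq (≤-trans (s≤s (≤-reflexive (IsNode.size node))) (m<m+n i z<s))) (m≤N m²<N)
    expanded : eval N expand (codeNode i P ∷ S ∷ codeℕ m ∷ codePerms bs ∷ codePerms as ∷ []) ≡
               foldr _•_ S (map childNode ys)
    expanded = subst
      (λ j → eval N expand (codeNode j P ∷ S ∷ codeℕ m ∷ codePerms bs ∷ codePerms as ∷ []) ≡
             foldr _•_ S (map (λ y → codeNode (suc j) ((k , y) ∷ P)) ys))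
      (toℕ-position i h eq) (expand-eval m²<N bs as bs≤N as≤N k P P<N S)
    1+h≤m : suc h ≤ m
    1+h≤m = subst (suc h ≤_) eq (m≤n+m (suc h) i)
    forest : ∀ zs → (∀ {y} → y ∈ zs → y ∈ ys) →
             SearchRuns F (foldr _•_ S (map childNode zs)) (concatMap (map (leafOutput N as) ∘ subleaves) zs ++ outs)
    -- Only a nonempty forest has the sharp bound that the induction uses. An empty one falls
    -- through to the stack below, for which just `F` is available.
    nonempty-forest : ∀ zs → (∀ {y} → y ∈ zs → y ∈ ys) → zs ≢ [] →
             SearchRuns (suc h * c) (foldr _•_ S (map childNode zs))
                        (concatMap (map (leafOutput N as) ∘ subleaves) zs ++ outs)
    forest []       _  = rest
    forest (z ∷ zs) ⊆ys = weaken (*-monoˡ-≤ c (≤-trans 1+h≤m (n≤1+n m))) (nonempty-forest (z ∷ zs) ⊆ys λ ())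
    nonempty-forest []       _   ≢[] = contradiction refl ≢[]
    nonempty-forest (z ∷ zs) ⊆ys _   =
      subst (SearchRuns _ _) (sym (++-assoc (map (leafOutput N as) (subleaves z)) _ outs))
        (search-node h (suc i) (next i h eq) ((k , z) ∷ P) _ (child-isNode bs as eq node (⊆ys (here refl)))
          (forest zs (⊆ys ∘ there)))

  search-root : SearchRuns F (codeNode {m} 0 [] • nil) (map (leafOutput N as) (leaves bs as m 0 refl []))
  search-root = subst (SearchRuns F _) (++-identityʳ _)
    (search-node m 0 refl [] nil (root-isNode bs as) (weaken (m≤m+n c (m * c)) search-empty))

-- The cost in terms of n and m

cost-mono : ∀ {k M N} (e : Expr k) → M ≤ N → cost M e ≤ cost N e
cost-mono (var i)      M≤N = ≤-refl
cost-mono nil          M≤N = ≤-refl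
cost-mono clock        M≤N = ≤-refl
cost-mono (cons a b)   M≤N = s≤s (+-mono-≤ (cost-mono a M≤N) (cost-mono b M≤N))
cost-mono (bind a b)   M≤N = s≤s (+-mono-≤ (cost-mono a M≤N) (cost-mono b M≤N))
cost-mono (case e a b) M≤N = s≤s (+-mono-≤ (cost-mono e M≤N) (+-mono-≤ (cost-mono a M≤N) (cost-mono b M≤N)))
cost-mono (fold l a b) M≤N =
  s≤s (+-monoˡ-≤ 3 (s≤s (+-mono-≤ (+-monoʳ-≤ 3 (+-mono-≤ (cost-mono l M≤N) (cost-mono a M≤N)))
    (+-monoˡ-≤ 8 (*-mono-≤ M≤N (+-monoʳ-≤ 20 (cost-mono b M≤N)))))))
cost-mono (app e is)   M≤N = cost-mono e M≤N

-- Exceeds m², the greatest size of a closure, and 2n, the greatest number of generators.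
clockLength : ℕ → ℕ → ℕ
clockLength n m = (n * 2 + suc m) * (n * 2 + suc m)

searchCost : ℕ → ℕ
searchCost N = (20 + (cost N clockBase + cost N clockSquare)) + (iterationCost N + suc N * iterationCost N)

opaque

  searchCost-poly : Polynomial searchCost
  searchCost-poly = poly-+ (poly-+ (poly-const 20) (poly-+ (cost-poly clockBase) (cost-poly clockSquare)))
      (poly-+ iteration (poly-* (poly-+ (poly-const 1) poly-id) iteration))
    where
    iteration : Polynomial iterationCost
    iteration = poly-+ (poly-const 10) (poly-+ (cost-poly unfinished) (poly-+ (cost-poly result) (cost-poly expand)))

^-distribʳ-* : ∀ a b e → (a * b) ^ e ≡ a ^ e * b ^ e
^-distribʳ-* a b zero    = refl
^-distribʳ-* a b (suc e) =
  trans (cong (a * b *_) (^-distribʳ-* a b e)) ([m*n]*[o*p]≡[m*o]*[n*p] a b (a ^ e) (b ^ e))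

1+clockLength≤ : ∀ n m → 1 + clockLength n m ≤ (3 * (1 + n + m)) ^ 2
1+clockLength≤ n m = begin
  1 + s * s              ≤⟨ +-mono-≤ (s≤s z≤n) (*-monoʳ-≤ s (n≤1+n s)) ⟩
  suc s * suc s          ≤⟨ *-mono-≤ 1+s≤ 1+s≤ ⟩
  (3 * q) * (3 * q)      ≡⟨ cong (3 * q *_) (*-identityʳ (3 * q)) ⟨
  (3 * q) ^ 2            ∎
  where
  open ≤-Reasoning
  q = 1 + n + m
  s = n * 2 + suc m
  1+s≤ : suc s ≤ 3 * q
  -- The summand `1 + n + 2 * m` is the difference of the two sides.
  1+s≤ = ≤-trans (m≤m+n (suc s) (1 + n + 2 * m)) (≤-reflexive
    (solve 2 (λ n m → (con 1 :+ (n :* con 2 :+ (con 1 :+ m))) :+ (con 1 :+ n :+ con 2 :* m) :=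
                      con 3 :* (con 1 :+ n :+ m)) refl n m))
    where open +-*-Solver

poly-clockLength : ∀ {f} → Polynomial f → ∃[ c ] ∃[ d ] (∀ n m → f (clockLength n m) ≤ c * (1 + n + m) ^ d)
poly-clockLength {f} (c , d , bound) = c * 3 ^ (2 * d) , 2 * d , λ n m → begin
  f (clockLength n m)                             ≤⟨ bound (clockLength n m) ⟩
  c * (1 + clockLength n m) ^ d                   ≤⟨ *-monoʳ-≤ c (^-monoˡ-≤ d (1+clockLength≤ n m)) ⟩
  c * ((3 * (1 + n + m)) ^ 2) ^ d                 ≡⟨ cong (c *_) (^-*-assoc (3 * (1 + n + m)) 2 d) ⟩
  c * (3 * (1 + n + m)) ^ (2 * d)                 ≡⟨ cong (c *_) (^-distribʳ-* 3 (1 + n + m) (2 * d)) ⟩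
  c * (3 ^ (2 * d) * (1 + n + m) ^ (2 * d))       ≡⟨ *-assoc c (3 ^ (2 * d)) _ ⟨
  c * 3 ^ (2 * d) * (1 + n + m) ^ (2 * d)         ∎
  where open ≤-Reasoning

module _ (n m : ℕ) (bs as : List (Permutation′ m)) (bs≤2n : length bs ≤ 2 * n) (as≤2n : length as ≤ 2 * n)
         (C-as⊆C-bs : ∀ {κ} → Commutes κ as → Commutes κ bs) (gM gG : Tree) where

  private
    s N : ℕ
    s = n * 2 + suc m
    N = clockLength n m

    s≤N : s ≤ N
    s≤N = m≤m*n s s {{>-nonZero (≤-trans (s≤s z≤n) (m≤n+m (suc m) (n * 2)))}}

    2n≤N : 2 * n ≤ N
    2n≤N = ≤-trans (≤-trans (≤-reflexive (*-comm 2 n)) (m≤m+n (n * 2) (suc m))) s≤N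

    n≤N : n ≤ N
    n≤N = ≤-trans (m≤m+n n (n + 0)) 2n≤N

    m≤N′ : m ≤ N
    m≤N′ = ≤-trans (≤-trans (n≤1+n m) (m≤n+m (suc m) (n * 2))) s≤N

  m²<clockLength : m * m < clockLength n m
  m²<clockLength = *-mono-< (m≤n+m (suc m) (n * 2)) (m≤n+m (suc m) (n * 2))

  bs≤N : length bs ≤ clockLength n m
  bs≤N = ≤-trans bs≤2n 2n≤N

  as≤N : length as ≤ clockLength n m
  as≤N = ≤-trans as≤2n 2n≤N

  codedInput : Tree
  codedInput = codeℕ n • codeℕ m • gM • codePerms bs • gG • codePerms as

  search-runs : ∃[ v ] ∃[ t ] ((codedInput ∷ []) ⊢ search ⇓ v ∣ t ×
    outputs t ≡ map (leafOutput (clockLength n m) as) (leaves bs as m 0 refl []) ×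
    All (_≤ searchCost (clockLength n m)) (marginalCosts t))
  search-runs =
    let v , t , run , outs≡ , costs = search-root m²<clockLength bs as bs≤N as≤N (λ {κ} → C-as⊆C-bs {κ})
        k , k≤ , whole =
          delayed-case-cons (runs-var 0F) (delayed-case-cons (runs-var 1F) (delayed-case-cons (runs-var 1F)
            (delayed-case-cons (runs-var 1F) (delayed-case-cons (runs-var 1F)
              (delayed-let base-runs (delayed-let square-runs (delayed-while
                (runs-cons (runs-cons runs-nil (runs-cons runs-nil runs-nil)) runs-nil) run)))))))
    in v , ticks k ++ t , whole , trans (outputs-ticks k t) outs≡
     , subst (All (_≤ searchCost N)) (sym (costs-ticks 0 k t))
         (costs k (+-mono-≤ (prologue≤ k≤) (≤-trans F≤ (m≤n+m _ (iterationCost N))))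
                  (≤-trans (+-monoʳ-≤ (iterationCost N) F≤) (m≤n+m _ (20 + (cost N clockBase + cost N clockSquare)))))
    where
    ρ : Vec Tree 11
    ρ = gG ∷ codePerms as ∷ codePerms bs ∷ (gG • codePerms as) ∷ gM ∷ (codePerms bs • gG • codePerms as) ∷
        codeℕ m ∷ (gM • codePerms bs • gG • codePerms as) ∷ codeℕ n ∷
        (codeℕ m • gM • codePerms bs • gG • codePerms as) ∷ codedInput ∷ []
    base-runs : Runs ρ (compile (Vec.lookup (8F ∷ 6F ∷ [])) 8F clockBase) (codeℕ s) (cost n clockBase)
    base-runs = subst (λ u → Runs ρ (compile (Vec.lookup (8F ∷ 6F ∷ [])) 8F clockBase) u (cost n clockBase))
      (clockBase-eval n m)
      (compile-runs clockBase {r = Vec.lookup (8F ∷ 6F ∷ [])} {σ = codeℕ n ∷ codeℕ m ∷ []} {ρ} refl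
        λ { 0F → refl ; 1F → refl })
    square-runs : Runs (codeℕ s ∷ ρ) (compile (Vec.lookup []) 0F clockSquare) (codeℕ N) (cost s clockSquare)
    square-runs = subst (λ u → Runs (codeℕ s ∷ ρ) (compile (Vec.lookup []) 0F clockSquare) u (cost s clockSquare))
      (clockSquare-eval s)
      (compile-runs clockSquare {r = Vec.lookup []} {σ = []} {codeℕ s ∷ ρ} refl λ ())
    F≤ : suc m * iterationCost N ≤ suc N * iterationCost N
    F≤ = *-monoˡ-≤ (iterationCost N) (s≤s m≤N′)
    prologue≤ : ∀ {k} → k ≤ 11 + (cost n clockBase + (1 + (cost s clockSquare + 8))) →
                k ≤ 20 + (cost N clockBase + cost N clockSquare)
    prologue≤ {k} k≤ = begin
      k                                      ≤⟨ k≤ ⟩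
      11 + (x + (1 + (y + 8)))               ≡⟨ solve 2 (λ x y → con 11 :+ (x :+ (con 1 :+ (y :+ con 8))) :=
                                                              con 20 :+ (x :+ y)) refl x y ⟩
      20 + (x + y)                           ≤⟨ +-monoʳ-≤ 20 (+-mono-≤
                                                  (cost-mono clockBase n≤N) (cost-mono clockSquare s≤N)) ⟩
      20 + (cost N clockBase + cost N clockSquare) ∎
      where
      open ≤-Reasoning
      open +-*-Solver
      x = cost n clockBase
      y = cost s clockSquare

-- Homomorphisms

CommuteWith : ∀ {m} → Permutation′ m → Permutation′ m → Set
CommuteWith κ g = ∀ x → κ ⟨$⟩ʳ (g ⟨$⟩ʳ x) ≡ g ⟨$⟩ʳ (κ ⟨$⟩ʳ x)

commute-resp : ∀ {m} {κ g h : Permutation′ m} → g ≈ₚ h → CommuteWith κ g → CommuteWith κ h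
commute-resp {κ = κ} g≈h κg x = trans (cong (κ ⟨$⟩ʳ_) (sym (g≈h x))) (trans (κg x) (g≈h (κ ⟨$⟩ʳ x)))

commute-inverse : ∀ {m} {κ g : Permutation′ m} → CommuteWith κ g → CommuteWith κ (flip g)
commute-inverse {κ = κ} {g} κg x = begin
  κ ⟨$⟩ʳ (g ⟨$⟩ˡ x)                          ≡⟨ inverseˡ g ⟨
  g ⟨$⟩ˡ (g ⟨$⟩ʳ (κ ⟨$⟩ʳ (g ⟨$⟩ˡ x)))        ≡⟨ cong (g ⟨$⟩ˡ_) (κg (g ⟨$⟩ˡ x)) ⟨
  g ⟨$⟩ˡ (κ ⟨$⟩ʳ (g ⟨$⟩ʳ (g ⟨$⟩ˡ x)))        ≡⟨ cong (λ y → g ⟨$⟩ˡ (κ ⟨$⟩ʳ y)) (inverseʳ g) ⟩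
  g ⟨$⟩ˡ (κ ⟨$⟩ʳ x)                          ∎
  where open ≡-Reasoning

conjugate-fixes⇔commutes : ∀ {m} {μ g : Permutation′ m} → (conjugate μ g ≈ₚ g) ⇔ CommuteWith μ g
conjugate-fixes⇔commutes {μ = μ} {g} = mk⇔
  (λ fixed x → trans (cong (μ ⟨$⟩ʳ_) (sym (fixed x))) (inverseʳ μ))
  (λ μg x → trans (cong (μ ⟨$⟩ˡ_) (sym (μg x))) (inverseˡ μ))

codePerm-cong : ∀ {m} {π ρ : Permutation′ m} → π ≈ₚ ρ → codePerm π ≡ codePerm ρ
codePerm-cong {m} π≈ρ = cong codeList (tabulate-cong {n = m} λ i → cong codeFin (π≈ρ i))

codePerms-map-cong : ∀ {m} {A : Set} {f g : A → Permutation′ m} as → (∀ {a} → a ∈ as → f a ≈ₚ g a) →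
                     codePerms (map f as) ≡ codePerms (map g as)
codePerms-map-cong []       f≈g = refl
codePerms-map-cong {f = f} {g} (a ∷ as) f≈g =
  cong₂ _•_ (codePerm-cong {π = f a} {g a} (f≈g (here refl))) (codePerms-map-cong as (λ a∈ → f≈g (there a∈)))

open GroupHomomorphism using (⟦_⟧; ⟦⟧-cong; ε-homo; homo; ⁻¹-homo)

module _ {n m : ℕ} {S : List (Permutation′ n)} where

  -- Reduces the centralizer of the image to that of the finitely many values in the input, by
  -- induction on the derivation of membership.
  commutes-with-image : (φ : Hom S m) {κ : Permutation′ m} → Commutes κ (valuesOnGenerators φ) →
                        ∀ {π} (p : π ∈⟨ S ⟩) → CommuteWith κ (⟦ φ ⟧ (π , p))
  commutes-with-image φ {κ} κφ (gen {π = π} π∈S) =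
    -- A homomorphism also takes the derivation of membership as an argument; `⟦⟧-cong` makes its
    -- value independent of it.
    commute-resp {κ = κ} {⟦ φ ⟧ (lookup S (index π∈S) , gen (∈-lookup (index π∈S)))} {⟦ φ ⟧ (π , gen π∈S)}
      (⟦⟧-cong φ λ x → cong (_⟨$⟩ʳ x) (sym (lookup-index π∈S))) (κφ (∈-tabulate⁺ (index π∈S)))
  commutes-with-image φ {κ} κφ unit =
    commute-resp {κ = κ} {idₚ} {⟦ φ ⟧ (idₚ , unit)} (λ x → sym (ε-homo φ x)) (λ _ → refl)
  commutes-with-image φ {κ} κφ (mult {π = π} {ρ} p q) =
    commute-resp {κ = κ} {⟦ φ ⟧ (π , p) ∘ₚ ⟦ φ ⟧ (ρ , q)} {⟦ φ ⟧ (π ∘ₚ ρ , mult p q)}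
      (λ x → sym (homo φ (π , p) (ρ , q) x))
      (λ x → trans (commutes-with-image φ {κ} κφ q (⟦ φ ⟧ (π , p) ⟨$⟩ʳ x))
                   (cong (⟦ φ ⟧ (ρ , q) ⟨$⟩ʳ_) (commutes-with-image φ {κ} κφ p x)))
  commutes-with-image φ {κ} κφ (inv {π = π} p) =
    commute-resp {κ = κ} {flip (⟦ φ ⟧ (π , p))} {⟦ φ ⟧ (flip π , inv p)}
      (λ x → sym (⁻¹-homo φ (π , p) x)) (commute-inverse {κ = κ} {⟦ φ ⟧ (π , p)} (commutes-with-image φ {κ} κφ p))
  commutes-with-image φ {κ} κφ (resp {π = π} {ρ} π≈ρ p) =
    commute-resp {κ = κ} {⟦ φ ⟧ (π , p)} {⟦ φ ⟧ (ρ , resp π≈ρ p)} (⟦⟧-cong φ π≈ρ) (commutes-with-image φ {κ} κφ p)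

  conjugateHom : Permutation′ m → Hom S m → Hom S m
  conjugateHom μ φ = record
    { ⟦_⟧ = λ g → conjugate μ (⟦ φ ⟧ g)
    ; isGroupHomomorphism = record
      { isMonoidHomomorphism = record
        { isMagmaHomomorphism = record
          { isRelHomomorphism = record
            { cong = λ g≈h x → cong (μ ⟨$⟩ˡ_) (⟦⟧-cong φ g≈h (μ ⟨$⟩ʳ x)) }
          ; homo = λ g h x → cong (μ ⟨$⟩ˡ_) (trans (homo φ g h (μ ⟨$⟩ʳ x)) (cong (⟦ φ ⟧ h ⟨$⟩ʳ_) (sym (inverseʳ μ))))
          }
        ; ε-homo = λ x → trans (cong (μ ⟨$⟩ˡ_) (ε-homo φ (μ ⟨$⟩ʳ x))) (inverseˡ μ)
        }
      ; ⁻¹-homo = λ g x → cong (μ ⟨$⟩ˡ_) (⁻¹-homo φ g (μ ⟨$⟩ʳ x))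
      }
    }

  codeHom-conjugate : ∀ {μ} (φ φ₀ : Hom S m) → (∀ g → ⟦ φ ⟧ g ≈ₚ conjugate μ (⟦ φ₀ ⟧ g)) →
                      codeHom φ ≡ codePerms (map (conjugate μ) (valuesOnGenerators φ₀))
  codeHom-conjugate {μ} φ φ₀ φ≈ = begin
    codeList (map codePerm (tabulate (λ i → ⟦ φ ⟧ (g i))))
      ≡⟨ cong codeList (map-tabulate (λ i → ⟦ φ ⟧ (g i)) codePerm) ⟩
    codeList (tabulate (λ i → codePerm (⟦ φ ⟧ (g i))))
      ≡⟨ cong codeList (tabulate-cong λ i → codePerm-cong {π = ⟦ φ ⟧ (g i)} {conjugate μ (⟦ φ₀ ⟧ (g i))} (φ≈ (g i))) ⟩
    codeList (tabulate (λ i → codePerm (conjugate μ (⟦ φ₀ ⟧ (g i)))))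
      ≡⟨ cong codeList (map-tabulate (λ i → conjugate μ (⟦ φ₀ ⟧ (g i))) codePerm) ⟨
    codePerms (tabulate (λ i → conjugate μ (⟦ φ₀ ⟧ (g i))))
      ≡⟨ cong codePerms (map-tabulate (λ i → ⟦ φ₀ ⟧ (g i)) (conjugate μ)) ⟨
    codePerms (map (conjugate μ) (valuesOnGenerators φ₀)) ∎
    where
    open ≡-Reasoning
    g : (i : Fin (length S)) → Group.Carrier ⟨ S ⟩
    g i = lookup S i , gen (∈-lookup i)

-- Extensions equivalent to the given one

module _ (I : ExtensionInstance) where

  open ExtensionInstance I

  bs as : List (Permutation′ m)
  bs = valuesOnGenerators ψ
  as = valuesOnGenerators φ₀

  -- Since φ₀ extends ψ, the members of `bs` are values of φ₀, to which `commutes-with-image`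
  -- applies.
  centralizer-⊆ : ∀ {κ} → Commutes κ as → Commutes κ bs
  centralizer-⊆ {κ} κas g∈bs with ∈-tabulate⁻ g∈bs
  ... | i , refl =
    commute-resp {κ = κ} {⟦ φ₀ ⟧ (π , M≤G π∈M)} {⟦ ψ ⟧ (π , π∈M)} (φ₀-extends π π∈M)
      (commutes-with-image φ₀ {κ} κas (M≤G π∈M))
    where
    π = lookup gensM i
    π∈M : π ∈⟨ gensM ⟩
    π∈M = gen (∈-lookup i)

  fixes-image : ∀ {μ} → Commutes μ bs → ∀ π (π∈M : π ∈⟨ gensM ⟩) → conjugate μ (⟦ φ₀ ⟧ (π , M≤G π∈M)) ≈ₚ ⟦ ψ ⟧ (π , π∈M)
  fixes-image {μ} μbs π π∈M x = trans
    (cong (μ ⟨$⟩ˡ_) (φ₀-extends π π∈M (μ ⟨$⟩ʳ x)))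
    (Equivalence.from (conjugate-fixes⇔commutes {μ = μ} {⟦ ψ ⟧ (π , π∈M)}) (commutes-with-image ψ {μ} μbs π∈M) x)

  commutes-of-extension : ∀ {μ φ} → Extends M≤G ψ φ → (∀ g → ⟦ φ ⟧ g ≈ₚ conjugate μ (⟦ φ₀ ⟧ g)) → Commutes μ bs
  commutes-of-extension {μ} {φ} φ-extends φ≈ g∈bs with ∈-tabulate⁻ g∈bs
  ... | i , refl = Equivalence.to (conjugate-fixes⇔commutes {μ = μ} {⟦ ψ ⟧ (π , π∈M)}) λ x →
    trans (cong (μ ⟨$⟩ˡ_) (sym (φ₀-extends π π∈M (μ ⟨$⟩ʳ x)))) (trans (sym (φ≈ (π , M≤G π∈M) x)) (φ-extends π π∈M x))
    where
    π = lookup gensM i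
    π∈M : π ∈⟨ gensM ⟩
    π∈M = gen (∈-lookup i)

  conjugate-coset : ∀ {μ κ} → Commutes κ as → ∀ {g} → g ∈ as → conjugate (μ ∘ₚ κ) g ≈ₚ conjugate μ g
  conjugate-coset {μ} {κ} κas {g} g∈as x =
    cong (μ ⟨$⟩ˡ_) (Equivalence.from (conjugate-fixes⇔commutes {μ = κ} {g}) (κas g∈as) (μ ⟨$⟩ʳ x))

  bs≤2n : length bs ≤ 2 * n
  bs≤2n = subst (_≤ 2 * n) (sym (length-tabulate λ i → ⟦ ψ ⟧ (lookup gensM i , gen (∈-lookup i)))) gensM≤2n

  as≤2n : length as ≤ 2 * n
  as≤2n = subst (_≤ 2 * n) (sym (length-tabulate λ i → ⟦ φ₀ ⟧ (lookup gensG i , gen (∈-lookup i)))) gensG≤2n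


  instance-clock : m * m < clockLength n m
  instance-clock = m²<clockLength n m bs as bs≤2n as≤2n (λ {κ} → centralizer-⊆ {κ}) nil nil

  instance-as≤N : length as ≤ clockLength n m
  instance-as≤N = as≤N n m bs as bs≤2n as≤2n (λ {κ} → centralizer-⊆ {κ}) nil nil

  outputTree : List (Pair m) → Tree
  outputTree = leafOutput (clockLength n m) as

  outputTree≡ : ∀ {Q μ} → IsNode bs as m Q → Maps μ Q → outputTree Q ≡ codePerms (map (conjugate μ) as)
  outputTree≡ {Q} {μ} = leafOutput≡ instance-clock bs as instance-as≤N {Q} {μ}

  root-leaves : List (List (Pair m))
  root-leaves = leaves bs as m 0 refl []

  outputs-sound : ∀ {x} → x ∈ map outputTree root-leaves → ∃[ φ ] (EquivalentToφ₀ φ × codeHom φ ≡ x)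
  outputs-sound x∈ with ∈-map⁻ outputTree x∈
  ... | Q , Q∈ , refl =
    let node = leaf-isNode bs as m {eq = refl} (root-isNode bs as) Q∈
        μ , μbs , μQ = IsNode.extends node
        φ = conjugateHom μ φ₀
    in φ , (fixes-image {μ} μbs , φ₀-extends , flip μ , λ _ _ → refl)
     , trans (codeHom-conjugate {μ = μ} φ φ₀ (λ _ _ → refl)) (sym (outputTree≡ {μ = μ} node μQ))

  -- The inverse of the conjugating permutation commutes with `bs`, so some leaf represents its
  -- coset; by `conjugate-coset` that leaf outputs the same homomorphism.
  outputs-complete : ∀ {φ} → EquivalentToφ₀ φ → codeHom φ ∈ map outputTree root-leaves
  outputs-complete {φ} (φ-extends , _ , l , φ≈) =
    let μ = flip l
        μbs = commutes-of-extension {μ} {φ} φ-extends φ≈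
        Q , κ , Q∈ , κas , μκQ =
          leaves-complete bs as (λ {κ} → centralizer-⊆ {κ}) m 0 refl [] μ μbs (λ ())
        node = leaf-isNode bs as m {eq = refl} (root-isNode bs as) Q∈
    in subst (_∈ map outputTree root-leaves)
         (trans (outputTree≡ {μ = μ ∘ₚ κ} node μκQ)
           (trans (codePerms-map-cong as (conjugate-coset {μ} {κ} κas)) (sym (codeHom-conjugate {μ = μ} φ φ₀ φ≈))))
         (∈-map⁺ outputTree Q∈)

corollary1p24 : EfficientlyEnumerable
    ExtensionInstance.n ExtensionInstance.m ExtensionInstance.input
    {Element = λ I → ExtensionInstance.Extension I} (λ {I} φ → codeHom φ)
    (λ I φ → ExtensionInstance.EquivalentToφ₀ I φ)
corollary1p24 =
  let c , d , bound = poly-clockLength searchCost-poly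
  in search , c , d , λ I →
    let open ExtensionInstance I using (n; m; gensM; gensG)
        v , t , run , outputs≡ , costs = search-runs n m (bs I) (as I) (bs≤2n I) (as≤2n I)
          (λ {κ} → centralizer-⊆ I {κ}) (codePerms gensM) (codePerms gensG)
    in v , t , run
     , subst Unique (sym outputs≡)
         (outputs-unique (bs I) (as I) (outputTree I) (λ {Q} {μ} → outputTree≡ I {Q} {μ})
           m 0 refl [] (root-isNode (bs I) (as I)))
     , (λ x → mk⇔ (λ x∈ → outputs-sound I (subst (x ∈_) outputs≡ x∈))
                  (λ { (φ , φ∈ , refl) → subst (codeHom φ ∈_) (sym outputs≡) (outputs-complete I {φ} φ∈) }))
     , All.map (λ ≤cost → ≤-trans ≤cost (bound n m)) costs
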